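{- For any positive integers $n$ and $d\ge 2$, and any $p=p(n)$, there exists an $n$-vertex directed graph $G$ and a set $\mathcal{P}$ of $p$ vertex pairs such that any 1-fault-tolerant reachability oracle of $G$ for $\mathcal{P}$ must have size $\Omega\big(n^{2/(d+1)}p^{(d-1)/d}\big)$ bits.
   Context: For a directed graph $G=(V,E)$ and $\mathcal{P}\subseteq V\times V$, a $k$-fault-tolerant reachability oracle of $G$ for $\mathcal{P}$ is a data structure that, given any pair $(s,t)\in\mathcal{P}$ and any set $F\subseteq E$ of at most $k$ edges, decides whether $t$ is reachable from $s$ in $G\setminus F$ (the graph with the edges of $F$ deleted). -}

module Defs where

open import Data.Nat using (ℕ)
open import Data.Bool using (Bool; true; false; _∧_; not)
open import Data.Fin using (Fin; _≟_)
open import Data.Maybe using (Maybe; just; nothing)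
open import Data.Product using (_×_; _,_)
open import Data.List using (List)
open import Data.List.Membership.Propositional using (_∈_)
open import Relation.Nullary.Decidable using (⌊_⌋)
open import Relation.Binary.PropositionalEquality using (_≡_)
open import Relation.Binary.Construct.Closure.ReflexiveTransitive using (Star)

Graph : ℕ → Set
Graph n = Fin n → Fin n → Bool

-- A fault set F of at most one edge: nothing = F empty, just e = F = {e}.
Fault : ℕ → Set
Fault n = Maybe (Fin n × Fin n)

FaultIn : ∀ {n} → Graph n → Fault n → Set
FaultIn G nothing        = Data.Unit.⊤ where import Data.Unit
FaultIn G (just (u , v)) = G u v ≡ true

delete : ∀ {n} → Graph n → Fault n → Graph n
delete G nothing        x y = G x y
delete G (just (u , v)) x y = G x y ∧ not (⌊ x ≟ u ⌋ ∧ ⌊ y ≟ v ⌋)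

Reach : ∀ {n} → Graph n → Fin n → Fin n → Set
Reach G s t = Star (λ x y → G x y ≡ true) s t

-- A data-structure scheme for 1-fault-tolerant reachability w.r.t. the pair
-- set P: an encoder mapping each n-vertex graph to a bit string (the oracle
-- stored for that graph) and a query algorithm reading only the bit string.
IsFTOracle : ∀ {n} → List (Fin n × Fin n)
           → (Graph n → List Bool)
           → (List Bool → Fin n → Fin n → Fault n → Bool) → Set
IsFTOracle {n} P enc query =
  (G : Graph n) (s t : Fin n) → (s , t) ∈ P → (F : Fault n) → FaultIn G F →
  (query (enc G) s t F ≡ true → Reach (delete G F) s t) ×
  (Reach (delete G F) s t → query (enc G) s t F ≡ true)

-- Encoding argument. Fix a dimension k, L layers and a box of base points and directions in ℕᵏ.
-- The graph has vertices (c, l, h, p) with a copy bit c, a layer l ≤ L, a height h and a point p,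
-- edges (0, l, h, p) → (1, l + 1, h + |q − p|², q) for all q, and edges (1, l, h, p) → (0, l, h, p).
-- A line with base height h₀, base x and direction a visits (h₀ + l|a|², x + l·a). The potential
-- 2⟨a, p⟩ − h − l|a|² is constant along the line and drops on every other edge, so a path between
-- the two ends of a line must follow it, and deleting its edge at layer l₀ disconnects the ends unless
-- a shortcut (0, l₀) → (0, l₀ + 1) is added. Adding the shortcuts selected by an arbitrary bit vector f
-- over all (line, l₀), the answers of a 1-fault-tolerant oracle for the line ends spell out f, so some
-- graph needs one bit per such query. With n ≈ u^(d+1), three choices of the box and of L
-- (for p ≲ u^d, u^d ≲ p ≲ u^(2d) and p ≳ u^(2d)) give the bound.

module Submission where

open import Defs
open import Data.Nat using (ℕ)

module MixedRadix where
  open import Data.Nat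
  open import Data.Nat.Properties
  open import Data.Nat.DivMod
  open import Data.Nat.Divisibility using (divides-refl)
  open import Data.Vec using (Vec; []; _∷_; replicate; _++_)
  open import Data.Vec.Relation.Binary.Pointwise.Inductive using (Pointwise; []; _∷_)
  open import Relation.Binary.PropositionalEquality

  -- Digits in the mixed radix (1 + r₀, 1 + r₁, …) given by rs, least significant first.
  Bounded : ∀ {m} → Vec ℕ m → Vec ℕ m → Set
  Bounded rs xs = Pointwise _≤_ xs rs

  capacity : ∀ {m} → Vec ℕ m → ℕ
  capacity []       = 1
  capacity (r ∷ rs) = suc r * capacity rs

  value : ∀ {m} → Vec ℕ m → Vec ℕ m → ℕ
  value []       []       = 0
  value (r ∷ rs) (x ∷ xs) = x + value rs xs * suc r

  digits : ∀ {m} → Vec ℕ m → ℕ → Vec ℕ m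
  digits []       i = []
  digits (r ∷ rs) i = i % suc r ∷ digits rs (i / suc r)

  digits-bounded : ∀ {m} (rs : Vec ℕ m) i → Bounded rs (digits rs i)
  digits-bounded []       i = []
  digits-bounded (r ∷ rs) i = m<1+n⇒m≤n (m%n<n i (suc r)) ∷ digits-bounded rs (i / suc r)

  digits-value : ∀ {m} {rs xs : Vec ℕ m} → Bounded rs xs → digits rs (value rs xs) ≡ xs
  digits-value [] = refl
  digits-value {rs = r ∷ rs} {x ∷ xs} (x≤r ∷ bnd) = cong₂ _∷_ low high
    where
    low : (x + value rs xs * suc r) % suc r ≡ x
    low = trans ([m+kn]%n≡m%n x (value rs xs) (suc r)) (m≤n⇒m%n≡m x≤r)
    high : digits rs ((x + value rs xs * suc r) / suc r) ≡ xs
    high = begin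
      digits rs ((x + value rs xs * suc r) / suc r)
        ≡⟨ cong (digits rs) (+-distrib-/-∣ʳ x (divides-refl (value rs xs))) ⟩
      digits rs (x / suc r + value rs xs * suc r / suc r)
        ≡⟨ cong₂ (λ a b → digits rs (a + b)) (m<n⇒m/n≡0 (s≤s x≤r)) (m*n/n≡m (value rs xs) (suc r)) ⟩
      digits rs (value rs xs)
        ≡⟨ digits-value bnd ⟩
      xs ∎
      where open ≡-Reasoning

  value<capacity : ∀ {m} {rs xs : Vec ℕ m} → Bounded rs xs → value rs xs < capacity rs
  value<capacity [] = s≤s z≤n
  value<capacity {rs = r ∷ rs} {x ∷ xs} (x≤r ∷ bnd) = begin-strict
    x + value rs xs * suc r     <⟨ +-monoˡ-< (value rs xs * suc r) (s≤s x≤r) ⟩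
    suc (value rs xs) * suc r   ≤⟨ *-monoˡ-≤ (suc r) (value<capacity bnd) ⟩
    capacity rs * suc r         ≡⟨ *-comm (capacity rs) (suc r) ⟩
    suc r * capacity rs         ∎
    where open ≤-Reasoning

  value-digits : ∀ {m} (rs : Vec ℕ m) i → i < capacity rs → value rs (digits rs i) ≡ i
  value-digits []       zero    _           = refl
  value-digits []       (suc i) (s≤s ())
  value-digits (r ∷ rs) i       i< = begin
    i % suc r + value rs (digits rs (i / suc r)) * suc r
      ≡⟨ cong (λ z → i % suc r + z * suc r) (value-digits rs (i / suc r) quotient<) ⟩
    i % suc r + i / suc r * suc r
      ≡⟨ sym (m≡m%n+[m/n]*n i (suc r)) ⟩
    i ∎
    where
    open ≡-Reasoning
    quotient< : i / suc r < capacity rs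
    quotient< = m<n*o⇒m/o<n (subst (i <_) (*-comm (suc r) (capacity rs)) i<)

  capacity-replicate : ∀ k r → capacity (replicate k r) ≡ suc r ^ k
  capacity-replicate zero    r = refl
  capacity-replicate (suc k) r = cong (suc r *_) (capacity-replicate k r)

  capacity-++ : ∀ {a b} (xs : Vec ℕ a) (ys : Vec ℕ b) → capacity (xs ++ ys) ≡ capacity xs * capacity ys
  capacity-++ []       ys = sym (+-identityʳ (capacity ys))
  capacity-++ (x ∷ xs) ys = trans (cong (suc x *_) (capacity-++ xs ys)) (sym (*-assoc (suc x) (capacity xs) (capacity ys)))

module Counting where
  open import Data.Nat
  open import Data.Nat.Properties
  open import Data.Bool using (Bool; true; false)
  open import Data.Vec using (Vec; []; _∷_)
  open import Data.List using (List; []; _∷_; length; map; _++_)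
  open import Data.List.Properties using (length-map; length-++; length-removeAt′)
  open import Data.List.Membership.Propositional using (_∈_; _─_)
  open import Data.List.Membership.Propositional.Properties using (∈-map⁺; ∈-map⁻; ∈-++⁺ˡ; ∈-++⁺ʳ)
  open import Data.List.Relation.Binary.Subset.Propositional using (_⊆_)
  open import Data.List.Relation.Unary.Any as Any using (here; there; any?; satisfied)
  open import Data.List.Relation.Unary.All as All using ([])
  open import Data.List.Relation.Unary.AllPairs using ([]; _∷_)
  open import Data.List.Relation.Unary.Unique.Propositional using (Unique)
  import Data.List.Relation.Unary.Unique.Propositional.Properties as Unique
  open import Data.Product using (Σ; _×_; _,_)
  open import Data.Empty using (⊥)
  open import Relation.Nullary using (yes; no; contradiction)
  open import Relation.Binary.PropositionalEquality

  module _ {A : Set} where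
    ∈-─ : ∀ {x y : A} {ys} (x∈ys : x ∈ ys) → y ∈ ys → x ≢ y → y ∈ ys ─ x∈ys
    ∈-─ (here refl)  (here refl)  x≢y = contradiction refl x≢y
    ∈-─ (here refl)  (there y∈ys) x≢y = y∈ys
    ∈-─ (there x∈ys) (here refl)  x≢y = here refl
    ∈-─ (there x∈ys) (there y∈ys) x≢y = there (∈-─ x∈ys y∈ys x≢y)

    Unique⇒length≤ : ∀ {xs ys : List A} → Unique xs → xs ⊆ ys → length xs ≤ length ys
    Unique⇒length≤ {[]}     _              _    = z≤n
    Unique⇒length≤ {x ∷ xs} {ys} (x∉xs ∷ u) xs⊆ys = begin
      suc (length xs)
        ≤⟨ s≤s (Unique⇒length≤ u (λ y∈xs → ∈-─ x∈ys (xs⊆ys (there y∈xs)) (All.lookup x∉xs y∈xs))) ⟩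
      suc (length (ys ─ x∈ys))  ≡⟨ sym (length-removeAt′ ys _) ⟩
      length ys                 ∎
      where
      open ≤-Reasoning
      x∈ys = xs⊆ys (here refl)

  bitVectors : ∀ M → List (Vec Bool M)
  bitVectors zero    = [] ∷ []
  bitVectors (suc M) = map (true ∷_) (bitVectors M) ++ map (false ∷_) (bitVectors M)

  length-bitVectors : ∀ M → length (bitVectors M) ≡ 2 ^ M
  length-bitVectors zero    = refl
  length-bitVectors (suc M) = begin
    length (map (true ∷_) (bitVectors M) ++ map (false ∷_) (bitVectors M))
      ≡⟨ length-++ (map (true ∷_) (bitVectors M)) ⟩
    length (map (true ∷_) (bitVectors M)) + length (map (false ∷_) (bitVectors M))
      ≡⟨ cong₂ _+_ (length-map _ (bitVectors M)) (length-map _ (bitVectors M)) ⟩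
    length (bitVectors M) + length (bitVectors M)
      ≡⟨ cong₂ _+_ (length-bitVectors M) (trans (length-bitVectors M) (sym (+-identityʳ (2 ^ M)))) ⟩
    2 ^ suc M ∎
    where open ≡-Reasoning

  bitVectors-unique : ∀ M → Unique (bitVectors M)
  bitVectors-unique zero    = [] ∷ []
  bitVectors-unique (suc M) =
    Unique.++⁺ (Unique.map⁺ ∷-injectiveʳ (bitVectors-unique M)) (Unique.map⁺ ∷-injectiveʳ (bitVectors-unique M)) disjoint
    where
    ∷-injectiveʳ : ∀ {b} {u v : Vec Bool M} → b ∷ u ≡ b ∷ v → u ≡ v
    ∷-injectiveʳ refl = refl
    disjoint : ∀ {v} → v ∈ map (true ∷_) (bitVectors M) × v ∈ map (false ∷_) (bitVectors M) → ⊥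
    disjoint (p , q) with ∈-map⁻ (true ∷_) p | ∈-map⁻ (false ∷_) q
    ... | _ , _ , refl | _ , _ , ()

  shorterThan : ℕ → List (List Bool)
  shorterThan zero    = []
  shorterThan (suc M) = [] ∷ (map (true ∷_) (shorterThan M) ++ map (false ∷_) (shorterThan M))

  length-shorterThan : ∀ M → length (shorterThan M) < 2 ^ M
  length-shorterThan zero    = s≤s z≤n
  length-shorterThan (suc M) = begin-strict
    suc (length (map (true ∷_) (shorterThan M) ++ map (false ∷_) (shorterThan M)))
      ≡⟨ cong suc (trans (length-++ (map (true ∷_) (shorterThan M)))
                         (cong₂ _+_ (length-map _ (shorterThan M)) (length-map _ (shorterThan M)))) ⟩
    suc (length (shorterThan M) + length (shorterThan M))
      <⟨ s≤s (+-monoʳ-< (length (shorterThan M)) (length-shorterThan M)) ⟩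
    suc (length (shorterThan M) + 2 ^ M)
      ≤⟨ +-monoˡ-≤ (2 ^ M) (length-shorterThan M) ⟩
    2 ^ M + 2 ^ M
      ≡⟨ cong (2 ^ M +_) (sym (+-identityʳ (2 ^ M))) ⟩
    2 ^ suc M ∎
    where open ≤-Reasoning

  ∈-shorterThan : ∀ M (l : List Bool) → length l < M → l ∈ shorterThan M
  ∈-shorterThan (suc M) []          _         = here refl
  ∈-shorterThan (suc M) (true ∷ l)  (s≤s l<M) =
    there (∈-++⁺ˡ (∈-map⁺ (true ∷_) (∈-shorterThan M l l<M)))
  ∈-shorterThan (suc M) (false ∷ l) (s≤s l<M) =
    there (∈-++⁺ʳ (map (true ∷_) (shorterThan M)) (∈-map⁺ (false ∷_) (∈-shorterThan M l l<M)))

  injection-has-long-value : ∀ M (h : Vec Bool M → List Bool) → (∀ {u v} → h u ≡ h v → u ≡ v) →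
                             Σ (Vec Bool M) λ v → M ≤ length (h v)
  injection-has-long-value M h h-injective with any? (λ v → M ≤? length (h v)) (bitVectors M)
  ... | yes long = satisfied long
  ... | no ¬long = contradiction images≤ (<⇒≱ (length-shorterThan M))
    where
    images-short : map h (bitVectors M) ⊆ shorterThan M
    images-short l∈ with ∈-map⁻ h l∈
    ... | v , v∈ , refl with M ≤? length (h v)
    ...   | yes M≤ = contradiction (Any.map (λ { refl → M≤ }) v∈) ¬long
    ...   | no  M≰ = ∈-shorterThan M (h v) (≰⇒> M≰)
    images≤ : 2 ^ M ≤ length (shorterThan M)
    images≤ = subst (_≤ length (shorterThan M)) (trans (length-map h (bitVectors M)) (length-bitVectors M))
                (Unique⇒length≤ (Unique.map⁺ h-injective (bitVectors-unique M)) images-short)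

module DistinctPairs where
  open import Data.Nat
  open import Data.Nat.Properties
  open import Data.Fin as Fin using (Fin; remQuot; combine)
  open import Data.Fin.Properties using (combine-remQuot)
  import Data.Fin.Properties as Fin
  open import Data.List using (List; _∷_; length; map; allFin; deduplicate)
  open import Data.List.Properties using (length-map; length-tabulate; length-deduplicate)
  open import Data.List.Membership.Propositional using (_∈_; _∉_)
  open import Data.List.Membership.Propositional.Properties using (∈-deduplicate⁺)
  import Data.List.Membership.DecPropositional as DecMembership
  open import Data.List.Relation.Binary.Subset.Propositional using (_⊆_)
  open import Data.List.Relation.Unary.Any using (there; satisfied)
  open import Data.List.Relation.Unary.All as All using (all?)
  open import Data.List.Relation.Unary.All.Properties using (¬All⇒Any¬; ¬Any⇒All¬)
  open import Data.List.Relation.Unary.AllPairs using (_∷_)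
  open import Data.List.Relation.Unary.Unique.Propositional using (Unique)
  import Data.List.Relation.Unary.Unique.DecPropositional.Properties as Unique
  open import Data.Product using (Σ; _×_; _,_; uncurry)
  open import Data.Product.Properties using (≡-dec)
  open import Relation.Nullary using (Dec; yes; no; contradiction)
  open import Relation.Binary.PropositionalEquality
  open Counting using (Unique⇒length≤)

  module _ {n : ℕ} where
    Pair = Fin n × Fin n

    _≟ᴾ_ : (a b : Pair) → Dec (a ≡ b)
    _≟ᴾ_ = ≡-dec Fin._≟_ Fin._≟_

    open DecMembership _≟ᴾ_ using (_∈?_)

    allPairs : List Pair
    allPairs = map (remQuot n) (allFin (n * n))

    allPairs-unique : Unique allPairs
    allPairs-unique = Unique.map⁺ remQuot-injective (Unique.allFin⁺ (n * n))
      where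
      remQuot-injective : ∀ {a b} → remQuot n a ≡ remQuot n b → a ≡ b
      remQuot-injective {a} {b} eq =
        trans (sym (combine-remQuot {n} n a)) (trans (cong (uncurry combine) eq) (combine-remQuot {n} n b))

    length-allPairs : length allPairs ≡ n * n
    length-allPairs = trans (length-map _ (allFin (n * n))) (length-tabulate (λ i → i))

    fresh-pair : ∀ {P} → Unique P → length P < n * n → Σ Pair (_∉ P)
    fresh-pair {P} u P<n² with all? (_∈? P) allPairs
    ... | yes all∈P = contradiction (subst (_≤ length P) length-allPairs
                        (Unique⇒length≤ allPairs-unique (All.lookup all∈P))) (<⇒≱ P<n²)
    ... | no ¬all∈P = satisfied (¬All⇒Any¬ (_∈? P) allPairs ¬all∈P)

    extend : ∀ k {P} → Unique P → length P + k ≤ n * n →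
             Σ (List Pair) λ P′ → Unique P′ × length P′ ≡ length P + k × P ⊆ P′
    extend zero    {P} u _   = P , u , sym (+-identityʳ _) , λ e∈ → e∈
    extend (suc k) {P} u P+k<n² with fresh-pair u (<-≤-trans (m<m+n (length P) (s≤s z≤n)) P+k<n²)
    ... | e , e∉P with extend k (¬Any⇒All¬ P e∉P ∷ u) (subst (_≤ n * n) (+-suc (length P) k) P+k<n²)
    ...   | P′ , u′ , len , P⊆P′ = P′ , u′ , trans len (sym (+-suc (length P) k)) , λ e∈ → P⊆P′ (there e∈)

    distinct-superlist : ∀ (Q : List Pair) p → length Q ≤ p → p ≤ n * n →
                         Σ (List Pair) λ P → Unique P × length P ≡ p × Q ⊆ P
    distinct-superlist Q p Q≤p p≤n² with extend (p ∸ length Q₀) (Unique.deduplicate-! _≟ᴾ_ Q)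
                                             (subst (_≤ n * n) (sym (m+[n∸m]≡n Q₀≤p)) p≤n²)
      where
      Q₀ = deduplicate _≟ᴾ_ Q
      Q₀≤p = ≤-trans (length-deduplicate _≟ᴾ_ Q) Q≤p
    ... | P , u , len , Q₀⊆P = P , u , trans len (m+[n∸m]≡n (≤-trans (length-deduplicate _≟ᴾ_ Q) Q≤p)) ,
                               λ e∈Q → Q₀⊆P (∈-deduplicate⁺ _≟ᴾ_ e∈Q)

module LatticeVectors where
  open import Data.Nat as ℕ using (suc)
  import Data.Nat.Properties as ℕ
  open import Data.Integer using (ℤ; +_; -[1+_]; _+_; _*_; _-_; ∣_∣)
  import Data.Integer.Properties as ℤ
  open import Data.Integer.Tactic.RingSolver using (solve-∀)
  import Data.Nat.Tactic.RingSolver as ℕ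
  open import Data.Vec using (Vec; []; _∷_; map; zipWith; head; tail)
  open import Data.Product using (_×_; _,_)
  open import Data.Sum using ([_,_]′)
  open import Function using (id)
  open import Relation.Binary.PropositionalEquality

  infixl 6 _⊕_ _⊖_ _+ᴺ_
  infixl 7 _∙_ _·ᴺ_

  toℤ : ∀ {k} → Vec ℕ k → Vec ℤ k
  toℤ = map (λ n → + n)

  _⊕_ _⊖_ : ∀ {k} → Vec ℤ k → Vec ℤ k → Vec ℤ k
  _⊕_ = zipWith _+_
  _⊖_ = zipWith _-_

  _∙_ : ∀ {k} → Vec ℤ k → Vec ℤ k → ℤ
  []       ∙ []       = + 0
  (a ∷ as) ∙ (b ∷ bs) = a * b + as ∙ bs

  ∣_∣² : ∀ {k} → Vec ℤ k → ℕ
  ∣ [] ∣²     = 0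
  ∣ x ∷ xs ∣² = ∣ x ∣ ℕ.* ∣ x ∣ ℕ.+ ∣ xs ∣²

  _+ᴺ_ : ∀ {k} → Vec ℕ k → Vec ℕ k → Vec ℕ k
  _+ᴺ_ = zipWith ℕ._+_

  _·ᴺ_ : ∀ {k} → ℕ → Vec ℕ k → Vec ℕ k
  l ·ᴺ a = map (l ℕ.*_) a

  ∥_∥² : ∀ {k} → Vec ℕ k → ℕ
  ∥ [] ∥²     = 0
  ∥ x ∷ xs ∥² = x ℕ.* x ℕ.+ ∥ xs ∥²

  ∙-distribˡ-⊕ : ∀ {k} (A P B : Vec ℤ k) → A ∙ (P ⊕ B) ≡ A ∙ P + A ∙ B
  ∙-distribˡ-⊕ []      []      []      = refl
  ∙-distribˡ-⊕ (a ∷ A) (p ∷ P) (b ∷ B) = trans (cong (_+_ (a * (p + b))) (∙-distribˡ-⊕ A P B)) (lemma a p b (A ∙ P) (A ∙ B))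
    where lemma : ∀ a p b x y → a * (p + b) + (x + y) ≡ a * p + x + (a * b + y)
          lemma = solve-∀

  ∙-self : ∀ {k} (A : Vec ℤ k) → A ∙ A ≡ + ∣ A ∣²
  ∙-self []      = refl
  ∙-self (a ∷ A) = trans (cong₂ _+_ (square a) (∙-self A)) (sym (ℤ.pos-+ (∣ a ∣ ℕ.* ∣ a ∣) ∣ A ∣²))
    where square : ∀ x → x * x ≡ + (∣ x ∣ ℕ.* ∣ x ∣)
          square (+ n)    = sym (ℤ.pos-* n n)
          square -[1+ n ] = refl

  ∙-toℤ-self : ∀ {k} (a : Vec ℕ k) → toℤ a ∙ toℤ a ≡ + ∥ a ∥²
  ∙-toℤ-self []       = refl
  ∙-toℤ-self (a ∷ as) = trans (cong₂ _+_ (sym (ℤ.pos-* a a)) (∙-toℤ-self as)) (sym (ℤ.pos-+ (a ℕ.* a) ∥ as ∥²))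

  ⊖-∙-⊖ : ∀ {k} (A B : Vec ℤ k) → (A ⊖ B) ∙ (A ⊖ B) ≡ A ∙ A + B ∙ B - + 2 * (A ∙ B)
  ⊖-∙-⊖ []      []      = refl
  ⊖-∙-⊖ (a ∷ A) (b ∷ B) = trans (cong (_+_ ((a - b) * (a - b))) (⊖-∙-⊖ A B)) (lemma a b (A ∙ A) (B ∙ B) (A ∙ B))
    where lemma : ∀ a b x y z → (a - b) * (a - b) + (x + y - + 2 * z) ≡ a * a + x + (b * b + y) - + 2 * (a * b + z)
          lemma = solve-∀

  ∣A⊖B∣²≡0⇒A≡B : ∀ {k} (A B : Vec ℤ k) → ∣ A ⊖ B ∣² ≡ 0 → A ≡ B
  ∣A⊖B∣²≡0⇒A≡B []      []      _  = refl
  ∣A⊖B∣²≡0⇒A≡B (a ∷ A) (b ∷ B) eq = cong₂ _∷_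
    (ℤ.i-j≡0⇒i≡j a b (ℤ.∣i∣≡0⇒i≡0 ([ id , id ]′ (ℕ.m*n≡0⇒m≡0∨n≡0 _ (ℕ.m+n≡0⇒m≡0 _ eq)))))
    (∣A⊖B∣²≡0⇒A≡B A B (ℕ.m+n≡0⇒n≡0 (∣ a - b ∣ ℕ.* ∣ a - b ∣) eq))

  ⊕-⊖-cancel : ∀ {k} (P Q : Vec ℤ k) → P ⊕ (Q ⊖ P) ≡ Q
  ⊕-⊖-cancel []      []      = refl
  ⊕-⊖-cancel (p ∷ P) (q ∷ Q) = cong₂ _∷_ (lemma p q) (⊕-⊖-cancel P Q)
    where lemma : ∀ p q → p + (q - p) ≡ q
          lemma = solve-∀

  toℤ-+ᴺ : ∀ {k} (x y : Vec ℕ k) → toℤ (x +ᴺ y) ≡ toℤ x ⊕ toℤ y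
  toℤ-+ᴺ []       []       = refl
  toℤ-+ᴺ (x ∷ xs) (y ∷ ys) = cong₂ _∷_ (ℤ.pos-+ x y) (toℤ-+ᴺ xs ys)

  toℤ-injective : ∀ {k} {x y : Vec ℕ k} → toℤ x ≡ toℤ y → x ≡ y
  toℤ-injective {x = []}     {[]}     _  = refl
  toℤ-injective {x = x ∷ xs} {y ∷ ys} eq = cong₂ _∷_ (ℤ.+-injective (cong head eq)) (toℤ-injective (cong tail eq))

  toℤ-+ᴺ-⊖ : ∀ {k} (p a : Vec ℕ k) → toℤ (p +ᴺ a) ⊖ toℤ p ≡ toℤ a
  toℤ-+ᴺ-⊖ []       []       = refl
  toℤ-+ᴺ-⊖ (p ∷ ps) (a ∷ as) = cong₂ _∷_ (trans (cong (_- + p) (ℤ.pos-+ p a)) (lemma (+ p) (+ a))) (toℤ-+ᴺ-⊖ ps as)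
    where lemma : ∀ p a → p + a - p ≡ a
          lemma = solve-∀

  ∙-·ᴺ : ∀ {k} (A : Vec ℤ k) l (a : Vec ℕ k) → A ∙ toℤ (l ·ᴺ a) ≡ + l * (A ∙ toℤ a)
  ∙-·ᴺ []      l []       = sym (ℤ.*-zeroʳ (+ l))
  ∙-·ᴺ (x ∷ A) l (a ∷ as) = trans (cong₂ (λ u v → x * u + v) (ℤ.pos-* l a) (∙-·ᴺ A l as)) (lemma x (+ l) (+ a) (A ∙ toℤ as))
    where lemma : ∀ x l a y → x * (l * a) + l * y ≡ l * (x * a + y)
          lemma = solve-∀

  +ᴺ-·ᴺ-suc : ∀ {k} (x a : Vec ℕ k) l → x +ᴺ l ·ᴺ a +ᴺ a ≡ x +ᴺ suc l ·ᴺ a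
  +ᴺ-·ᴺ-suc []       []       l = refl
  +ᴺ-·ᴺ-suc (x ∷ xs) (a ∷ as) l = cong₂ _∷_ (lemma x a l) (+ᴺ-·ᴺ-suc xs as l)
    where lemma : ∀ x a l → x ℕ.+ l ℕ.* a ℕ.+ a ≡ x ℕ.+ (a ℕ.+ l ℕ.* a)
          lemma = ℕ.solve-∀

  ∙-line : ∀ {k} (x a : Vec ℕ k) l → toℤ a ∙ toℤ (x +ᴺ l ·ᴺ a) ≡ toℤ a ∙ toℤ x + + l * + ∥ a ∥²
  ∙-line x a l = begin
    toℤ a ∙ toℤ (x +ᴺ l ·ᴺ a)             ≡⟨ cong (toℤ a ∙_) (toℤ-+ᴺ x (l ·ᴺ a)) ⟩
    toℤ a ∙ (toℤ x ⊕ toℤ (l ·ᴺ a))        ≡⟨ ∙-distribˡ-⊕ (toℤ a) (toℤ x) _ ⟩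
    toℤ a ∙ toℤ x + toℤ a ∙ toℤ (l ·ᴺ a)  ≡⟨ cong (_+_ (toℤ a ∙ toℤ x)) (∙-·ᴺ (toℤ a) l a) ⟩
    toℤ a ∙ toℤ x + + l * (toℤ a ∙ toℤ a) ≡⟨ cong (λ z → toℤ a ∙ toℤ x + + l * z) (∙-toℤ-self a) ⟩
    toℤ a ∙ toℤ x + + l * + ∥ a ∥²        ∎
    where open ≡-Reasoning

  line-step-injective : ∀ {k} l (x a x′ a′ : Vec ℕ k) → x +ᴺ l ·ᴺ a ≡ x′ +ᴺ l ·ᴺ a′ →
                        x +ᴺ suc l ·ᴺ a ≡ x′ +ᴺ suc l ·ᴺ a′ → x ≡ x′ × a ≡ a′
  line-step-injective l []       []       []         []         _   _   = refl , refl
  line-step-injective l (x ∷ xs) (a ∷ as) (x′ ∷ xs′) (a′ ∷ as′) eqˡ eqˢ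
    with line-step-injective l xs as xs′ as′ (cong tail eqˡ) (cong tail eqˢ)
  ... | xs≡ , as≡ = cong₂ _∷_ x≡x′ xs≡ , cong₂ _∷_ a≡a′ as≡
    where
    a≡a′ : a ≡ a′
    a≡a′ = ℕ.+-cancelˡ-≡ (x′ ℕ.+ l ℕ.* a′) a a′ (trans (cong (ℕ._+ a) (sym (cong head eqˡ)))
             (trans (sym (lemma x a l)) (trans (cong head eqˢ) (lemma x′ a′ l))))
      where lemma : ∀ x a l → x ℕ.+ (a ℕ.+ l ℕ.* a) ≡ x ℕ.+ l ℕ.* a ℕ.+ a
            lemma = ℕ.solve-∀
    x≡x′ : x ≡ x′
    x≡x′ = ℕ.+-cancelʳ-≡ (l ℕ.* a) x x′ (trans (cong head eqˡ) (cong (λ z → x′ ℕ.+ l ℕ.* z) (sym a≡a′)))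

module Paraboloid {k : ℕ} where
  open import Data.Nat as ℕ using (suc)
  import Data.Nat.Properties as ℕ
  import Data.Nat.Tactic.RingSolver as ℕ
  open import Data.Integer using (ℤ; +_; _+_; _*_; _-_)
  import Data.Integer.Properties as ℤ
  open import Data.Integer.Tactic.RingSolver using (solve-∀)
  open import Data.Vec using (Vec)
  open import Data.Product using (_×_; _,_)
  open import Relation.Binary.PropositionalEquality
  open LatticeVectors

  Lift : ℕ → Vec ℕ k → ℕ → Vec ℕ k → Set
  Lift h p h′ q = + h′ ≡ + h + (toℤ q ⊖ toℤ p) ∙ (toℤ q ⊖ toℤ p)

  potential : Vec ℕ k → ℕ → ℕ → Vec ℕ k → ℤ
  potential a l h p = + 2 * (toℤ a ∙ toℤ p) - + h - + l * + ∥ a ∥²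

  -- Hence the potential never increases along a lift, and stays constant exactly on steps by a.
  potential-lift : ∀ a l {h p h′ q} → Lift h p h′ q →
                   potential a (suc l) h′ q + + ∣ toℤ a ⊖ (toℤ q ⊖ toℤ p) ∣² ≡ potential a l h p
  potential-lift a l {h} {p} {h′} {q} lift = begin
    + 2 * (A ∙ toℤ q) - + h′ - + suc l * + S + + ∣ A ⊖ B ∣²
      ≡⟨ cong₂ (λ u v → + 2 * u - + h′ - + suc l * + S + v) A∙q (sym (∙-self (A ⊖ B))) ⟩
    + 2 * (A ∙ P + A ∙ B) - + h′ - + suc l * + S + (A ⊖ B) ∙ (A ⊖ B)
      ≡⟨ cong₂ (λ u v → + 2 * (A ∙ P + A ∙ B) - u - + suc l * + S + v) lift (⊖-∙-⊖ A B) ⟩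
    + 2 * (A ∙ P + A ∙ B) - (+ h + B ∙ B) - + suc l * + S + (A ∙ A + B ∙ B - + 2 * (A ∙ B))
      ≡⟨ cong₂ (λ u v → + 2 * (A ∙ P + A ∙ B) - (+ h + B ∙ B) - u * + S + (v + B ∙ B - + 2 * (A ∙ B)))
               (ℤ.pos-+ 1 l) (∙-toℤ-self a) ⟩
    + 2 * (A ∙ P + A ∙ B) - (+ h + B ∙ B) - (+ 1 + + l) * + S + (+ S + B ∙ B - + 2 * (A ∙ B))
      ≡⟨ lemma (A ∙ P) (A ∙ B) (+ h) (B ∙ B) (+ l) (+ S) ⟩
    potential a l h p ∎
    where
    open ≡-Reasoning
    A = toℤ a
    P = toℤ p
    B = toℤ q ⊖ P
    S = ∥ a ∥²
    A∙q : A ∙ toℤ q ≡ A ∙ P + A ∙ B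
    A∙q = trans (cong (A ∙_) (sym (⊕-⊖-cancel P (toℤ q)))) (∙-distribˡ-⊕ A P B)
    lemma : ∀ ap ab h bb l s → + 2 * (ap + ab) - (h + bb) - (+ 1 + l) * s + (s + bb - + 2 * ab)
                             ≡ + 2 * ap - h - l * s
    lemma = solve-∀

  potential-line : ∀ a x xh l → potential a l (xh ℕ.+ l ℕ.* ∥ a ∥²) (x +ᴺ l ·ᴺ a) ≡ + 2 * (toℤ a ∙ toℤ x) - + xh
  potential-line a x xh l = begin
    + 2 * (toℤ a ∙ toℤ (x +ᴺ l ·ᴺ a)) - + (xh ℕ.+ l ℕ.* S) - + l * + S
      ≡⟨ cong₂ (λ u v → + 2 * u - v - + l * + S) (∙-line x a l)
               (trans (ℤ.pos-+ xh (l ℕ.* S)) (cong (_+_ (+ xh)) (ℤ.pos-* l S))) ⟩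
    + 2 * (toℤ a ∙ toℤ x + + l * + S) - (+ xh + + l * + S) - + l * + S
      ≡⟨ lemma (toℤ a ∙ toℤ x) (+ l) (+ S) (+ xh) ⟩
    + 2 * (toℤ a ∙ toℤ x) - + xh ∎
    where
    open ≡-Reasoning
    S = ∥ a ∥²
    lemma : ∀ d l s x → + 2 * (d + l * s) - (x + l * s) - l * s ≡ + 2 * d - x
    lemma = solve-∀

  lift-line : ∀ a x xh l → Lift (xh ℕ.+ l ℕ.* ∥ a ∥²) (x +ᴺ l ·ᴺ a) (xh ℕ.+ suc l ℕ.* ∥ a ∥²) (x +ᴺ suc l ·ᴺ a)
  lift-line a x xh l = begin
    + (xh ℕ.+ suc l ℕ.* S)                     ≡⟨ cong +_ (lemma xh l S) ⟩
    + (xh ℕ.+ l ℕ.* S ℕ.+ S)                   ≡⟨ ℤ.pos-+ (xh ℕ.+ l ℕ.* S) S ⟩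
    + (xh ℕ.+ l ℕ.* S) + + S                   ≡⟨ cong (_+_ (+ (xh ℕ.+ l ℕ.* S))) (sym (∙-toℤ-self a)) ⟩
    + (xh ℕ.+ l ℕ.* S) + toℤ a ∙ toℤ a         ≡⟨ cong (λ B → + (xh ℕ.+ l ℕ.* S) + B ∙ B) (sym step) ⟩
    + (xh ℕ.+ l ℕ.* S) + (toℤ q ⊖ toℤ p) ∙ (toℤ q ⊖ toℤ p) ∎
    where
    open ≡-Reasoning
    S = ∥ a ∥²
    p = x +ᴺ l ·ᴺ a
    q = x +ᴺ suc l ·ᴺ a
    step : toℤ q ⊖ toℤ p ≡ toℤ a
    step = trans (cong (λ z → toℤ z ⊖ toℤ p) (sym (+ᴺ-·ᴺ-suc x a l))) (toℤ-+ᴺ-⊖ p a)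
    lemma : ∀ x l s → x ℕ.+ (s ℕ.+ l ℕ.* s) ≡ x ℕ.+ l ℕ.* s ℕ.+ s
    lemma = ℕ.solve-∀

  lift-exact : ∀ a x xh l {h′ q} → Lift (xh ℕ.+ l ℕ.* ∥ a ∥²) (x +ᴺ l ·ᴺ a) h′ q →
               ∣ toℤ a ⊖ (toℤ q ⊖ toℤ (x +ᴺ l ·ᴺ a)) ∣² ≡ 0 →
               h′ ≡ xh ℕ.+ suc l ℕ.* ∥ a ∥² × q ≡ x +ᴺ suc l ·ᴺ a
  lift-exact a x xh l {h′} {q} lift exact = h′≡ , q≡
    where
    p = x +ᴺ l ·ᴺ a
    S = ∥ a ∥²
    a≡q-p : toℤ a ≡ toℤ q ⊖ toℤ p
    a≡q-p = ∣A⊖B∣²≡0⇒A≡B (toℤ a) (toℤ q ⊖ toℤ p) exact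
    q≡ : q ≡ x +ᴺ suc l ·ᴺ a
    q≡ = trans (toℤ-injective (trans (sym (⊕-⊖-cancel (toℤ p) (toℤ q)))
                 (trans (cong (toℤ p ⊕_) (sym a≡q-p)) (sym (toℤ-+ᴺ p a)))))
               (+ᴺ-·ᴺ-suc x a l)
    h′≡ : h′ ≡ xh ℕ.+ suc l ℕ.* S
    h′≡ = trans (ℤ.+-injective (begin
      + h′                                   ≡⟨ lift ⟩
      + (xh ℕ.+ l ℕ.* S) + (toℤ q ⊖ toℤ p) ∙ (toℤ q ⊖ toℤ p)
        ≡⟨ cong (λ B → + (xh ℕ.+ l ℕ.* S) + B ∙ B) (sym a≡q-p) ⟩
      + (xh ℕ.+ l ℕ.* S) + toℤ a ∙ toℤ a      ≡⟨ cong (_+_ (+ (xh ℕ.+ l ℕ.* S))) (∙-toℤ-self a) ⟩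
      + (xh ℕ.+ l ℕ.* S) + + S               ≡⟨ sym (ℤ.pos-+ (xh ℕ.+ l ℕ.* S) S) ⟩
      + (xh ℕ.+ l ℕ.* S ℕ.+ S)               ∎)) (lemma xh l S)
      where
      open ≡-Reasoning
      lemma : ∀ x l s → x ℕ.+ l ℕ.* s ℕ.+ s ≡ x ℕ.+ (s ℕ.+ l ℕ.* s)
      lemma = ℕ.solve-∀

module Deletion where
  open import Data.Bool using (true; false)
  open import Data.Fin using (Fin; _≟_)
  open import Data.Maybe using (just)
  open import Data.Product using (_×_; _,_)
  open import Relation.Nullary using (¬_; yes; no; contradiction)
  open import Relation.Binary.PropositionalEquality

  delete-edge⁻ : ∀ {n} (G : Graph n) {u v x y : Fin n} → delete G (just (u , v)) x y ≡ true →
                 G x y ≡ true × ¬ (x ≡ u × y ≡ v)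
  delete-edge⁻ G {u} {v} {x} {y} kept with G x y | x ≟ u | y ≟ v
  ... | true | yes refl | yes refl = contradiction kept (λ ())
  ... | true | yes _    | no y≢v   = refl , λ (_ , y≡v) → y≢v y≡v
  ... | true | no x≢u   | _        = refl , λ (x≡u , _) → x≢u x≡u
  delete-edge⁻ G () | false | _ | _

  delete-edge⁺ : ∀ {n} (G : Graph n) {u v x y : Fin n} → G x y ≡ true → ¬ (x ≡ u × y ≡ v) →
                 delete G (just (u , v)) x y ≡ true
  delete-edge⁺ G {u} {v} {x} {y} edge other rewrite edge with x ≟ u | y ≟ v
  ... | yes x≡u | yes y≡v = contradiction (x≡u , y≡v) other
  ... | yes _   | no _    = refl
  ... | no _    | _       = refl

module LowerBound where
  open import Data.Bool using (Bool)
  open import Data.Fin using (Fin)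
  open import Data.List using (List; length)
  open import Data.List.Relation.Unary.Unique.Propositional using (Unique)
  open import Data.Product using (Σ; _×_; _,_)
  open import Relation.Binary.PropositionalEquality using (_≡_)

  OracleLowerBound : (n p : ℕ) → (ℕ → Set) → Set
  OracleLowerBound n p Big = Σ (List (Fin n × Fin n)) λ P → Unique P × length P ≡ p ×
    ((enc : Graph n → List Bool) (query : List Bool → Fin n → Fin n → Fault n → Bool) →
      IsFTOracle P enc query → Σ (Graph n) λ G → Big (length (enc G)))

  OracleLowerBound-mono : ∀ {n p} {A B : ℕ → Set} → (∀ {s} → A s → B s) → OracleLowerBound n p A → OracleLowerBound n p B
  OracleLowerBound-mono A⇒B (P , unique , length≡p , bound) = P , unique , length≡p , λ enc query correct →
    let G , big = bound enc query correct in G , A⇒B big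

module Layout (k L₀ σ a₀ b₀ : ℕ) where
  open import Data.Nat
  open import Data.Nat.Properties
  open import Data.Nat.DivMod using (_%_; _/_; m%n<n)
  open import Data.Bool using (Bool; true; false)
  import Data.Bool.Properties as Bool
  open import Data.Fin as Fin using (Fin; toℕ)
  import Data.Fin.Properties as Fin
  open import Data.Integer as ℤ using (ℤ; +_; +<+)
  import Data.Integer.Properties as ℤ
  open import Data.Vec using (Vec; []; _∷_; replicate; _++_; head; tail; take; drop; lookup)
  open import Data.Vec.Properties using (take++drop≡id; ≡-dec)
  open import Data.Vec.Relation.Binary.Pointwise.Inductive using (Pointwise; []; _∷_; ++ˡ⁻; ++ʳ⁻)
  open import Data.Product using (Σ; _×_; _,_; proj₁; proj₂)
  open import Data.Sum using (_⊎_; inj₁; inj₂)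
  open import Relation.Nullary using (¬_; Dec; yes; no; contradiction; _×-dec_; _⊎-dec_)
  open import Relation.Binary.PropositionalEquality
  open MixedRadix
  open LatticeVectors
  open Paraboloid

  L : ℕ
  L = suc L₀

  -- A vertex is (copy c ∈ {0,1}, layer l ∈ [0,L], height h, point p ∈ ℕᵏ).
  Vertex : Set
  Vertex = Vec ℕ (3 + k)

  -- A line is (height, base point, direction), the direction being the last k entries.
  LineCode : Set
  LineCode = Vec ℕ (1 + (k + k))

  vertexRadices : Vec ℕ (3 + k)
  vertexRadices = 1 ∷ L ∷ b₀ + L * (k * (σ * σ)) ∷ replicate k (a₀ + L * σ)

  lineRadices : Vec ℕ (1 + (k + k))
  lineRadices = b₀ ∷ (replicate k a₀ ++ replicate k σ)

  queryRadices : Vec ℕ (2 + (k + k))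
  queryRadices = L₀ ∷ lineRadices

  vertexCount lineCount queryCount : ℕ
  vertexCount = capacity vertexRadices
  lineCount   = capacity lineRadices
  queryCount  = capacity queryRadices

  vertexCount≡ : vertexCount ≡ 2 * (suc L * (suc (b₀ + L * (k * (σ * σ))) * suc (a₀ + L * σ) ^ k))
  vertexCount≡ = cong (λ z → 2 * (suc L * (suc (b₀ + L * (k * (σ * σ))) * z))) (capacity-replicate k (a₀ + L * σ))

  lineCount≡ : lineCount ≡ suc b₀ * (suc a₀ ^ k * suc σ ^ k)
  lineCount≡ = cong (suc b₀ *_)
    (trans (capacity-++ (replicate k a₀) (replicate k σ)) (cong₂ _*_ (capacity-replicate k a₀) (capacity-replicate k σ)))

  height : LineCode → ℕ
  height = head

  base direction : LineCode → Vec ℕ k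
  base      ℓ = take k (tail ℓ)
  direction ℓ = drop k (tail ℓ)

  onLine : ℕ → ℕ → LineCode → Vertex
  onLine c l ℓ = c ∷ l ∷ height ℓ + l * ∥ direction ℓ ∥² ∷ base ℓ +ᴺ l ·ᴺ direction ℓ

  LineCode-ext : ∀ {ℓ ℓ′} → height ℓ ≡ height ℓ′ → base ℓ ≡ base ℓ′ → direction ℓ ≡ direction ℓ′ →
                 ℓ ≡ ℓ′
  LineCode-ext {h ∷ r} {h′ ∷ r′} h≡ x≡ a≡ =
    cong₂ _∷_ h≡ (trans (sym (take++drop≡id k r)) (trans (cong₂ _++_ x≡ a≡) (take++drop≡id k r′)))

  onLine-injective : ∀ {l l′ ℓ ℓ′} → onLine 0 l ℓ ≡ onLine 0 l′ ℓ′ → onLine 0 (suc l) ℓ ≡ onLine 0 (suc l′) ℓ′ →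
                     l ≡ l′ × ℓ ≡ ℓ′
  onLine-injective {l} {ℓ = ℓ} {ℓ′} atl atsuc with cong (λ v → head (tail v)) atl
  ... | refl = refl , LineCode-ext h≡ x≡ a≡
    where
    points = line-step-injective l (base ℓ) (direction ℓ) (base ℓ′) (direction ℓ′)
               (cong (λ v → tail (tail (tail v))) atl) (cong (λ v → tail (tail (tail v))) atsuc)
    x≡ = proj₁ points
    a≡ = proj₂ points
    h≡ : height ℓ ≡ height ℓ′
    h≡ = +-cancelʳ-≡ (l * ∥ direction ℓ ∥²) _ _
           (trans (cong (λ v → head (tail (tail v))) atl) (cong (λ a → height ℓ′ + l * ∥ a ∥²) (sym a≡)))

  base-bounded : ∀ {ℓ} → Bounded lineRadices ℓ → Bounded (replicate k a₀) (base ℓ)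
  base-bounded {h ∷ r} (_ ∷ bnd) =
    ++ˡ⁻ (take k r) (replicate k a₀) (subst (λ z → Pointwise _≤_ z _) (sym (take++drop≡id k r)) bnd)

  direction-bounded : ∀ {ℓ} → Bounded lineRadices ℓ → Bounded (replicate k σ) (direction ℓ)
  direction-bounded {h ∷ r} (_ ∷ bnd) =
    ++ʳ⁻ (take k r) (replicate k a₀) (subst (λ z → Pointwise _≤_ z _) (sym (take++drop≡id k r)) bnd)

  ∥∥²-bounded : ∀ {n} {a : Vec ℕ n} → Bounded (replicate n σ) a → ∥ a ∥² ≤ n * (σ * σ)
  ∥∥²-bounded []          = z≤n
  ∥∥²-bounded (a≤σ ∷ bnd) = +-mono-≤ (*-mono-≤ a≤σ a≤σ) (∥∥²-bounded bnd)

  point-bounded : ∀ {n l} {x a : Vec ℕ n} → l ≤ L → Bounded (replicate n a₀) x → Bounded (replicate n σ) a →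
                  Bounded (replicate n (a₀ + L * σ)) (x +ᴺ l ·ᴺ a)
  point-bounded l≤L []          []          = []
  point-bounded l≤L (x≤ ∷ bndx) (a≤ ∷ bnda) = +-mono-≤ x≤ (*-mono-≤ l≤L a≤) ∷ point-bounded l≤L bndx bnda

  onLine-bounded : ∀ {c l ℓ} → c ≤ 1 → l ≤ L → Bounded lineRadices ℓ → Bounded vertexRadices (onLine c l ℓ)
  onLine-bounded {ℓ = h ∷ r} c≤1 l≤L bnd@(h≤ ∷ _) =
    c≤1 ∷ l≤L ∷ +-mono-≤ h≤ (*-mono-≤ l≤L (∥∥²-bounded (direction-bounded bnd)))
        ∷ point-bounded l≤L (base-bounded bnd) (direction-bounded bnd)

  faultLayer : Fin queryCount → ℕ
  faultLayer i = toℕ i % L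

  queryLine : Fin queryCount → LineCode
  queryLine i = digits lineRadices (toℕ i / L)

  faultLayer<L : ∀ i → faultLayer i < L
  faultLayer<L i = m%n<n (toℕ i) L

  queryLine-bounded : ∀ i → Bounded lineRadices (queryLine i)
  queryLine-bounded i = digits-bounded lineRadices (toℕ i / L)

  query-injective : ∀ {i j} → faultLayer i ≡ faultLayer j → queryLine i ≡ queryLine j → i ≡ j
  query-injective {i} {j} l≡ ℓ≡ = Fin.toℕ-injective (begin
    toℕ i                                       ≡⟨ sym (value-digits queryRadices (toℕ i) (Fin.toℕ<n i)) ⟩
    value queryRadices (faultLayer i ∷ queryLine i) ≡⟨ cong₂ (λ l ℓ → value queryRadices (l ∷ ℓ)) l≡ ℓ≡ ⟩
    value queryRadices (faultLayer j ∷ queryLine j) ≡⟨ value-digits queryRadices (toℕ j) (Fin.toℕ<n j) ⟩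
    toℕ j                                       ∎)
    where open ≡-Reasoning

  shortcutSource shortcutTarget : Fin queryCount → Vertex
  shortcutSource i = onLine 0 (faultLayer i) (queryLine i)
  shortcutTarget i = onLine 0 (suc (faultLayer i)) (queryLine i)

  shortcut-injective : ∀ {i j} → shortcutSource i ≡ shortcutSource j → shortcutTarget i ≡ shortcutTarget j → i ≡ j
  shortcut-injective s≡ t≡ = let l≡ , ℓ≡ = onLine-injective s≡ t≡ in query-injective l≡ ℓ≡

  Shortcut : Vec Bool queryCount → Vertex → Vertex → Set
  Shortcut f u v = Σ (Fin queryCount) λ i → u ≡ shortcutSource i × v ≡ shortcutTarget i × lookup f i ≡ true

  shortcut? : ∀ f u v → Dec (Shortcut f u v)
  shortcut? f u v = Fin.any? (λ i → ≡-dec _≟_ u (shortcutSource i) ×-dec ≡-dec _≟_ v (shortcutTarget i)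
                                    ×-dec lookup f i Bool.≟ true)

  LayerEdge : Vec Bool queryCount → Vertex → Vertex → Set
  LayerEdge f u@(c ∷ l ∷ h ∷ p) v@(c′ ∷ l′ ∷ h′ ∷ q) =
      (c ≡ 0 × c′ ≡ 1 × l′ ≡ suc l × Lift h p h′ q)
    ⊎ (c ≡ 1 × c′ ≡ 0 × l′ ≡ l × h′ ≡ h × q ≡ p)
    ⊎ (c ≡ 0 × c′ ≡ 0 × l′ ≡ suc l × Lift h p h′ q × Shortcut f u v)

  layerEdge? : ∀ f u v → Dec (LayerEdge f u v)
  layerEdge? f u@(c ∷ l ∷ h ∷ p) v@(c′ ∷ l′ ∷ h′ ∷ q) =
        (c ≟ 0 ×-dec c′ ≟ 1 ×-dec l′ ≟ suc l ×-dec lift? h p h′ q)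
    ⊎-dec (c ≟ 1 ×-dec c′ ≟ 0 ×-dec l′ ≟ l ×-dec h′ ≟ h ×-dec ≡-dec _≟_ q p)
    ⊎-dec (c ≟ 0 ×-dec c′ ≟ 0 ×-dec l′ ≟ suc l ×-dec lift? h p h′ q ×-dec shortcut? f u v)
    where lift? : ∀ h p h′ q → Dec (Lift h p h′ q)
          lift? h p h′ q = + h′ ℤ.≟ _

  module FaultInvariant (ℓ : LineCode) (l₀ : ℕ) where
    private
      a = direction ℓ
      S = ∥ a ∥²

      +ℕ≡⇒≤ : ∀ {i j n} → i ℤ.+ + n ≡ j → i ℤ.≤ j
      +ℕ≡⇒≤ {i} {n = n} refl = ℤ.i≤i+j i (+ n)

      +suc≡⇒< : ∀ {i j n} → i ℤ.+ + suc n ≡ j → i ℤ.< j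
      +suc≡⇒< {i} {n = n} refl = subst (ℤ._< i ℤ.+ + suc n) (ℤ.+-identityʳ i) (ℤ.+-monoʳ-< i (+<+ (s≤s z≤n)))

    Φ₀ : ℤ
    Φ₀ = + 2 ℤ.* (toℤ a ∙ toℤ (base ℓ)) ℤ.- + height ℓ

    OnLine : ℕ → ℕ → Vec ℕ k → Set
    OnLine l h p = h ≡ height ℓ + l * S × p ≡ base ℓ +ᴺ l ·ᴺ a

    Safe : ℕ → ℕ → Vec ℕ k → Set
    Safe l h p = (l ≤ l₀ × OnLine l h p) ⊎ potential a l h p ℤ.< Φ₀

    Invariant : Vertex → Set
    Invariant (c ∷ l ∷ h ∷ p) = Safe l h p

    lift-preserves-Safe : ∀ {l h p h′ q} → Lift h p h′ q → Safe l h p →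
                          Safe (suc l) h′ q ⊎ (l ≡ l₀ × OnLine l h p × OnLine (suc l) h′ q)
    lift-preserves-Safe {l} lift (inj₂ below) =
      inj₁ (inj₂ (ℤ.≤-<-trans (+ℕ≡⇒≤ (potential-lift a l lift)) below))
    lift-preserves-Safe {l} {_} {_} {h′} {q} lift (inj₁ (l≤l₀ , refl , refl))
      with ∣ toℤ a ⊖ (toℤ q ⊖ toℤ (base ℓ +ᴺ l ·ᴺ a)) ∣² in off
    ... | suc δ = inj₁ (inj₂ (+suc≡⇒< (trans (cong (λ x → potential a (suc l) h′ q ℤ.+ + x) (sym off))
                                             (trans (potential-lift a l lift) (potential-line a (base ℓ) (height ℓ) l)))))
    ... | zero with lift-exact a (base ℓ) (height ℓ) l lift off | suc l ≤? l₀
    ...   | onLine′ | yes l<l₀ = inj₁ (inj₁ (l<l₀ , onLine′))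
    ...   | onLine′ | no  l≮l₀ = inj₂ (≤-antisym l≤l₀ (≮⇒≥ l≮l₀) , (refl , refl) , onLine′)

    edge-preserves-Invariant : ∀ {f u v} → LayerEdge f u v →
                               ¬ (u ≡ onLine 0 l₀ ℓ × v ≡ onLine 1 (suc l₀) ℓ) →
                               ¬ Shortcut f (onLine 0 l₀ ℓ) (onLine 0 (suc l₀) ℓ) →
                               Invariant u → Invariant v
    edge-preserves-Invariant {u = _ ∷ _ ∷ _ ∷ _} {_ ∷ _ ∷ _ ∷ _} (inj₁ (refl , refl , refl , lift)) notFault _ safe
      with lift-preserves-Safe lift safe
    ... | inj₁ safe′ = safe′
    ... | inj₂ (refl , (refl , refl) , (refl , refl)) = contradiction (refl , refl) notFault
    edge-preserves-Invariant {u = _ ∷ _ ∷ _ ∷ _} {_ ∷ _ ∷ _ ∷ _} (inj₂ (inj₁ (refl , refl , refl , refl , refl))) _ _ safe = safe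
    edge-preserves-Invariant {u = _ ∷ _ ∷ _ ∷ _} {_ ∷ _ ∷ _ ∷ _}
                             (inj₂ (inj₂ (refl , refl , refl , lift , shortcut))) _ noShortcut safe
      with lift-preserves-Safe lift safe
    ... | inj₁ safe′ = safe′
    ... | inj₂ (refl , (refl , refl) , (refl , refl)) = contradiction shortcut noShortcut

    start-Invariant : ∀ c → Invariant (onLine c 0 ℓ)
    start-Invariant c = inj₁ (z≤n , refl , refl)

    end-¬Invariant : ∀ {c l} → l₀ < l → ¬ Invariant (onLine c l ℓ)
    end-¬Invariant l₀<l (inj₁ (l≤l₀ , _)) = <⇒≱ l₀<l l≤l₀
    end-¬Invariant {l = l} l₀<l (inj₂ below) =
      ℤ.<-irrefl (potential-line a (base ℓ) (height ℓ) l) below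

  no-shortcut : ∀ {f i} → lookup f i ≡ false → ¬ Shortcut f (shortcutSource i) (shortcutTarget i)
  no-shortcut {i = i} off (j , s≡ , t≡ , on) with shortcut-injective {i} {j} s≡ t≡
  ... | refl = contradiction (trans (sym on) off) λ ()

  module OnVertices (m : ℕ) (vertexCount≤ : vertexCount ≤ suc m) where
    open import Data.Nat.DivMod using (_mod_; m<n⇒m%n≡m; m<n*o⇒m/o<n)
    open import Data.Maybe using (just)
    open import Data.List using (List; length; map; upTo)
    open import Data.List.Properties using (length-map; length-upTo)
    open import Data.List.Membership.Propositional using (_∈_)
    open import Data.List.Membership.Propositional.Properties using (∈-map⁺; ∈-upTo⁺)
    open import Data.List.Relation.Binary.Subset.Propositional using (_⊆_)
    open import Data.Vec.Properties using (tabulate∘lookup; tabulate-cong)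
    open import Function.Bundles using (_⇔_; mk⇔; Equivalence)
    open import Relation.Nullary.Decidable using (does; dec-true)
    open import Relation.Binary.Construct.Closure.ReflexiveTransitive using (Star; ε; _◅_; _◅◅_; fold)
    open Deletion
    open DistinctPairs using (distinct-superlist)
    open LowerBound

    -- Reducing mod (m + 1) is the identity on bounded D and only spares carrying the bound around.
    vertex : Vertex → Fin (suc m)
    vertex D = value vertexRadices D mod suc m

    decode : Fin (suc m) → Vertex
    decode x = digits vertexRadices (toℕ x)

    toℕ-vertex : ∀ {D} → Bounded vertexRadices D → toℕ (vertex D) ≡ value vertexRadices D
    toℕ-vertex bnd = trans (Fin.toℕ-fromℕ< _) (m<n⇒m%n≡m (<-≤-trans (value<capacity bnd) vertexCount≤))

    decode-vertex : ∀ {D} → Bounded vertexRadices D → decode (vertex D) ≡ D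
    decode-vertex bnd = trans (cong (digits vertexRadices) (toℕ-vertex bnd)) (digits-value bnd)

    vertex-decode : ∀ {x} → toℕ x < vertexCount → vertex (decode x) ≡ x
    vertex-decode {x} x< = Fin.toℕ-injective
      (trans (toℕ-vertex (digits-bounded vertexRadices (toℕ x))) (value-digits vertexRadices (toℕ x) x<))

    vertex<count : ∀ {D} → Bounded vertexRadices D → toℕ (vertex D) < vertexCount
    vertex<count bnd = subst (_< vertexCount) (sym (toℕ-vertex bnd)) (value<capacity bnd)

    vertex-injective : ∀ {D D′} → Bounded vertexRadices D → Bounded vertexRadices D′ → vertex D ≡ vertex D′ → D ≡ D′
    vertex-injective bnd bnd′ eq = trans (sym (decode-vertex bnd)) (trans (cong decode eq) (decode-vertex bnd′))

    Edge : Vec Bool queryCount → Fin (suc m) → Fin (suc m) → Set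
    Edge f x y = toℕ x < vertexCount × toℕ y < vertexCount × LayerEdge f (decode x) (decode y)

    edge? : ∀ f x y → Dec (Edge f x y)
    edge? f x y = toℕ x <? vertexCount ×-dec toℕ y <? vertexCount ×-dec layerEdge? f (decode x) (decode y)

    opaque
      graph : Vec Bool queryCount → Graph (suc m)
      graph f x y = does (edge? f x y)

      graph-edge⁺ : ∀ {f D D′} → Bounded vertexRadices D → Bounded vertexRadices D′ → LayerEdge f D D′ →
                    graph f (vertex D) (vertex D′) ≡ true
      graph-edge⁺ {f} bnd bnd′ e = dec-true (edge? f _ _)
        (vertex<count bnd , vertex<count bnd′ , subst₂ (LayerEdge f) (sym (decode-vertex bnd)) (sym (decode-vertex bnd′)) e)

      graph-edge⁻ : ∀ {f x y} → graph f x y ≡ true → Edge f x y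
      graph-edge⁻ {f} {x} {y} = does≡true⇒ (edge? f x y)
        where does≡true⇒ : ∀ {P : Set} (P? : Dec P) → does P? ≡ true → P
              does≡true⇒ (yes p) _ = p

    lineVertex : ℕ → ℕ → Fin queryCount → Fin (suc m)
    lineVertex c l i = vertex (onLine c l (queryLine i))

    source target : Fin queryCount → Fin (suc m)
    source = lineVertex 0 0
    target = lineVertex 0 L

    fault : Fin queryCount → Fault (suc m)
    fault i = just (lineVertex 0 (faultLayer i) i , lineVertex 1 (suc (faultLayer i)) i)

    module _ (f : Vec Bool queryCount) (i : Fin queryCount) where
      private
        ℓ  = queryLine i
        l₀ = faultLayer i
        open FaultInvariant ℓ l₀

        Step : Fin (suc m) → Fin (suc m) → Set
        Step x y = delete (graph f) (fault i) x y ≡ true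

        bounded : ∀ {c l} → c ≤ 1 → l ≤ L → Bounded vertexRadices (onLine c l ℓ)
        bounded c≤1 l≤L = onLine-bounded c≤1 l≤L (queryLine-bounded i)

      fault-in-graph : FaultIn (graph f) (fault i)
      fault-in-graph = graph-edge⁺ (bounded z≤n (<⇒≤ (faultLayer<L i))) (bounded ≤-refl (faultLayer<L i))
                         (inj₁ (refl , refl , refl , lift-line (direction ℓ) (base ℓ) (height ℓ) l₀))

      step-preserves-Invariant : lookup f i ≡ false → ∀ {x y} → Step x y → Invariant (decode x) → Invariant (decode y)
      step-preserves-Invariant off {x} {y} step =
        edge-preserves-Invariant {f} layerEdge notFault (no-shortcut {f} {i} off)
        where
        kept : graph f x y ≡ true × ¬ (x ≡ lineVertex 0 l₀ i × y ≡ lineVertex 1 (suc l₀) i)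
        kept = delete-edge⁻ (graph f) step
        edge : Edge f x y
        edge = graph-edge⁻ (proj₁ kept)
        layerEdge : LayerEdge f (decode x) (decode y)
        layerEdge = proj₂ (proj₂ edge)
        notFault : ¬ (decode x ≡ onLine 0 l₀ ℓ × decode y ≡ onLine 1 (suc l₀) ℓ)
        notFault (x≡ , y≡) = proj₂ kept (trans (sym (vertex-decode (proj₁ edge))) (cong vertex x≡) ,
                                         trans (sym (vertex-decode (proj₁ (proj₂ edge)))) (cong vertex y≡))

      unreachable-without-shortcut : lookup f i ≡ false → ¬ Reach (delete (graph f) (fault i)) (source i) (target i)
      unreachable-without-shortcut off path = end-¬Invariant {0} (faultLayer<L i)
        (subst Invariant (decode-vertex (bounded z≤n ≤-refl))
          (fold (λ x y → Invariant (decode x) → Invariant (decode y))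
                (λ step rest inv → rest (step-preserves-Invariant off step inv)) (λ inv → inv) path
                (subst Invariant (sym (decode-vertex (bounded z≤n z≤n))) (start-Invariant 0))))

      private
        keep : ∀ {c c′ l l′} → c ≤ 1 → c′ ≤ 1 → l ≤ L → l′ ≤ L →
               LayerEdge f (onLine c l ℓ) (onLine c′ l′ ℓ) →
               ¬ (onLine c l ℓ ≡ onLine 0 l₀ ℓ × onLine c′ l′ ℓ ≡ onLine 1 (suc l₀) ℓ) →
               Step (lineVertex c l i) (lineVertex c′ l′ i)
        keep c≤ c′≤ l≤ l′≤ e notFault = delete-edge⁺ (graph f) (graph-edge⁺ (bounded c≤ l≤) (bounded c′≤ l′≤) e)
          λ (x≡ , y≡) → notFault (vertex-injective (bounded c≤ l≤) (bounded z≤n (<⇒≤ (faultLayer<L i))) x≡ ,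
                                  vertex-injective (bounded c′≤ l′≤) (bounded ≤-refl (faultLayer<L i)) y≡)

        advance : lookup f i ≡ true → ∀ j → j < L → Star Step (lineVertex 0 j i) (lineVertex 0 (suc j) i)
        advance on j j<L with j ≟ l₀
        ... | yes refl = keep z≤n z≤n (<⇒≤ j<L) j<L shortcut (λ (_ , copy≡) → 0≢1 (cong head copy≡)) ◅ ε
          where
          0≢1 : 0 ≢ 1
          0≢1 ()
          shortcut = inj₂ (inj₂ (refl , refl , refl , lift-line (direction ℓ) (base ℓ) (height ℓ) j , i , refl , refl , on))
        ... | no j≢l₀ = keep z≤n ≤-refl (<⇒≤ j<L) j<L up (λ (layer≡ , _) → j≢l₀ (cong (λ v → head (tail v)) layer≡))
                      ◅ keep ≤-refl z≤n j<L j<L back (λ (copy≡ , _) → 1≢0 (cong head copy≡))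
                      ◅ ε
          where
          1≢0 : 1 ≢ 0
          1≢0 ()
          up   = inj₁ (refl , refl , refl , lift-line (direction ℓ) (base ℓ) (height ℓ) j)
          back = inj₂ (inj₁ (refl , refl , refl , refl , refl))

      reachable-with-shortcut : lookup f i ≡ true → Reach (delete (graph f) (fault i)) (source i) (target i)
      reachable-with-shortcut on = walk L ≤-refl
        where
        walk : ∀ j → j ≤ L → Star Step (source i) (lineVertex 0 j i)
        walk zero    _   = ε
        walk (suc j) j<L = walk j (<⇒≤ j<L) ◅◅ advance on j j<L

      reachable⇔shortcut : Reach (delete (graph f) (fault i)) (source i) (target i) ⇔ lookup f i ≡ true
      reachable⇔shortcut = mk⇔ reachable⇒shortcut reachable-with-shortcut
        where
        reachable⇒shortcut : Reach (delete (graph f) (fault i)) (source i) (target i) → lookup f i ≡ true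
        reachable⇒shortcut path with lookup f i in on
        ... | true  = refl
        ... | false = contradiction path (unreachable-without-shortcut on)

    linePairs : List (Fin (suc m) × Fin (suc m))
    linePairs = map endpoints (upTo lineCount)
      where endpoints : ℕ → Fin (suc m) × Fin (suc m)
            endpoints j = vertex (onLine 0 0 (digits lineRadices j)) , vertex (onLine 0 L (digits lineRadices j))

    length-linePairs : length linePairs ≡ lineCount
    length-linePairs = trans (length-map _ (upTo lineCount)) (length-upTo lineCount)

    query∈linePairs : ∀ i → (source i , target i) ∈ linePairs
    query∈linePairs i = ∈-map⁺ _ (∈-upTo⁺ (m<n*o⇒m/o<n (subst (toℕ i <_) (*-comm L lineCount) (Fin.toℕ<n i))))

    oracle-decodes-shortcuts : ∀ {P} enc query → IsFTOracle P enc query → linePairs ⊆ P →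
                               ∀ f i → query (enc (graph f)) (source i) (target i) (fault i) ≡ lookup f i
    oracle-decodes-shortcuts enc query correct lines⊆P f i = Bool.⇔→≡ (mk⇔
      (λ answered → Equivalence.to (reachable⇔shortcut f i) (proj₁ answer answered))
      (λ on → proj₂ answer (Equivalence.from (reachable⇔shortcut f i) on)))
      where answer = correct (graph f) (source i) (target i) (lines⊆P (query∈linePairs i)) (fault i) (fault-in-graph f i)

    oracle-size : ∀ {P} enc query → IsFTOracle P enc query → linePairs ⊆ P →
                  Σ (Graph (suc m)) λ G → queryCount ≤ length (enc G)
    oracle-size enc query correct lines⊆P with injection-has-long-value queryCount (λ f → enc (graph f)) enc∘graph-injective
      where
      open Counting
      enc∘graph-injective : ∀ {f f′} → enc (graph f) ≡ enc (graph f′) → f ≡ f′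
      enc∘graph-injective {f} {f′} eq = trans (sym (tabulate∘lookup f)) (trans (tabulate-cong λ i → begin
        lookup f i                                                ≡⟨ sym (oracle-decodes-shortcuts enc query correct lines⊆P f i) ⟩
        query (enc (graph f)) (source i) (target i) (fault i)     ≡⟨ cong (λ b → query b (source i) (target i) (fault i)) eq ⟩
        query (enc (graph f′)) (source i) (target i) (fault i)    ≡⟨ oracle-decodes-shortcuts enc query correct lines⊆P f′ i ⟩
        lookup f′ i                                               ∎) (tabulate∘lookup f′))
        where open ≡-Reasoning
    ... | f , long = graph f , long

    queries-lower-bound : ∀ p → lineCount ≤ p → p ≤ suc m * suc m → OracleLowerBound (suc m) p (queryCount ≤_)
    queries-lower-bound p lines≤p p≤n² with distinct-superlist linePairs p (subst (_≤ p) (sym length-linePairs) lines≤p) p≤n²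
    ... | P , unique , length≡p , lines⊆P = P , unique , length≡p , λ enc query correct → oracle-size enc query correct lines⊆P

module Arithmetic where
  open import Data.Nat
  open import Data.Nat.Properties
  open import Data.Nat.DivMod using (_/_; _%_; m≡m%n+[m/n]*n; m%n<n; m≥n⇒m/n>0)
  import Data.Nat.Tactic.RingSolver as ℕ
  open import Data.Product using (Σ; _×_; _,_)
  open import Relation.Nullary using (¬_; Dec; yes; no; contradiction)
  open import Relation.Binary.PropositionalEquality

  ^-distribʳ-* : ∀ a b e → (a * b) ^ e ≡ a ^ e * b ^ e
  ^-distribʳ-* a b zero    = refl
  ^-distribʳ-* a b (suc e) = trans (cong (a * b *_) (^-distribʳ-* a b e)) (lemma a b (a ^ e) (b ^ e))
    where lemma : ∀ a b x y → a * b * (x * y) ≡ a * x * (b * y)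
          lemma = ℕ.solve-∀

  ^-mono-≤-* : ∀ e {x c y} → x ≤ c * y → x ^ e ≤ c ^ e * y ^ e
  ^-mono-≤-* e {x} {c} {y} x≤cy = subst (x ^ e ≤_) (^-distribʳ-* c y e) (^-monoˡ-≤ e x≤cy)

  1≤^ : ∀ e {x} → 1 ≤ x → 1 ≤ x ^ e
  1≤^ zero    _   = s≤s z≤n
  1≤^ (suc e) 1≤x = *-mono-≤ 1≤x (1≤^ e 1≤x)

  m≤m^n : ∀ m n → 1 ≤ n → m ≤ m ^ n
  m≤m^n zero    (suc n) _ = z≤n
  m≤m^n (suc m) (suc n) _ = subst (_≤ suc m * suc m ^ n) (*-identityʳ (suc m)) (*-monoʳ-≤ (suc m) (1≤^ n (s≤s z≤n)))

  m≤c*m : ∀ m {c} → 1 ≤ c → m ≤ c * m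
  m≤c*m m {c} 1≤c = subst (_≤ c * m) (*-identityˡ m) (*-monoˡ-≤ m 1≤c)

  m≤m*c : ∀ m {c} → 1 ≤ c → m ≤ m * c
  m≤m*c m {c} 1≤c = subst (_≤ m * c) (*-identityʳ m) (*-monoʳ-≤ m 1≤c)

  1+m≤2m : ∀ {m} → 1 ≤ m → suc m ≤ 2 * m
  1+m≤2m {m} 1≤m = subst (suc m ≤_) (cong (m +_) (sym (+-identityʳ m))) (+-monoˡ-≤ m 1≤m)

  suc-^≤ : ∀ e {x} → 1 ≤ x → suc x ^ e ≤ 2 ^ e * x ^ e
  suc-^≤ e 1≤x = ^-mono-≤-* e (1+m≤2m 1≤x)

  m≤2*[m/n]*n : ∀ m n .{{_ : NonZero n}} → n ≤ m → m ≤ 2 * (m / n * n)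
  m≤2*[m/n]*n m n n≤m = begin
    m                         ≡⟨ m≡m%n+[m/n]*n m n ⟩
    m % n + m / n * n         ≤⟨ +-monoˡ-≤ (m / n * n) (≤-trans (<⇒≤ (m%n<n m n)) (m≤c*m n (m≥n⇒m/n>0 n≤m))) ⟩
    m / n * n + m / n * n     ≡⟨ cong (m / n * n +_) (sym (+-identityʳ (m / n * n))) ⟩
    2 * (m / n * n)           ∎
    where open ≤-Reasoning

  <c[1+u]ᵉ⇒≤c2ᵉuᵉ : ∀ c e {n u} → 1 ≤ u → n < c * suc u ^ e → n ≤ c * 2 ^ e * u ^ e
  <c[1+u]ᵉ⇒≤c2ᵉuᵉ c e {u = u} 1≤u n< =
    ≤-trans (<⇒≤ n<) (subst (c * suc u ^ e ≤_) (sym (*-assoc c (2 ^ e) (u ^ e))) (*-monoʳ-≤ c (suc-^≤ e 1≤u)))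

  last-before-failure : ∀ (P : ℕ → Set) → (∀ v → Dec (P v)) → ∀ B v → P v → ¬ P (v + B) →
                        Σ ℕ λ w → v ≤ w × P w × ¬ P (suc w)
  last-before-failure P P? zero    v pv ¬pv+B = contradiction (subst P (sym (+-identityʳ v)) pv) ¬pv+B
  last-before-failure P P? (suc B) v pv ¬pv+B with P? (suc v)
  ... | no ¬psv = v , ≤-refl , pv , ¬psv
  ... | yes psv with last-before-failure P P? B (suc v) psv (λ p → ¬pv+B (subst P (sym (+-suc v B)) p))
  ...   | w , sv≤w , pw , ¬psw = w , ≤-trans (n≤1+n v) sv≤w , pw , ¬psw

  largest-power-below : ∀ c e X → 1 ≤ c → 1 ≤ e → c ≤ X → Σ ℕ λ v → 1 ≤ v × c * v ^ e ≤ X × X < c * suc v ^ e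
  largest-power-below c e X 1≤c 1≤e c≤X
    with last-before-failure (λ v → c * v ^ e ≤ X) (λ v → c * v ^ e ≤? X) X 1
           (subst (_≤ X) (sym (trans (cong (c *_) (^-zeroˡ e)) (*-identityʳ c))) c≤X) too-big
    where
    too-big : ¬ (c * suc X ^ e ≤ X)
    too-big le = <⇒≱ (≤-trans (m≤m^n (suc X) e 1≤e) (m≤c*m (suc X ^ e) 1≤c)) le
  ... | v , 1≤v , fits , ¬fits = v , 1≤v , fits , ≰⇒> ¬fits

module Estimates (k : ℕ) where
  open import Data.Nat
  open import Data.Nat.Properties
  import Data.Nat.Tactic.RingSolver as ℕ
  open import Relation.Binary.PropositionalEquality
  open Arithmetic
  open ≤-Reasoning

  d e E k₃ : ℕ
  d  = suc k
  e  = d + 1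
  E  = d * e
  k₃ = k * (k + 3)

  ^-^-comm : ∀ x a b → (x ^ a) ^ b ≡ (x ^ b) ^ a
  ^-^-comm x a b = trans (^-*-assoc x a b) (trans (cong (x ^_) (*-comm a b)) (sym (^-*-assoc x b a)))

  sparse-estimate : ∀ {n p u c L} → p ≤ c * u ^ d → u ^ e ≤ n → n ≤ 8 * L →
                    n ^ (2 * d) * p ^ (k * e) ≤ (c ^ (k * e) * 8 ^ E) * L ^ E
  sparse-estimate {n} {p} {u} {c} {L} p≤ u^e≤n n≤8L = begin
    n ^ (2 * d) * p ^ (k * e)                       ≤⟨ *-monoʳ-≤ (n ^ (2 * d)) (^-mono-≤-* (k * e) {p} {c} {u ^ d} p≤) ⟩
    n ^ (2 * d) * (c ^ (k * e) * (u ^ d) ^ (k * e)) ≡⟨ cong (λ z → n ^ (2 * d) * (c ^ (k * e) * z)) u^dke≡ ⟩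
    n ^ (2 * d) * (c ^ (k * e) * (u ^ e) ^ (d * k)) ≤⟨ *-monoʳ-≤ (n ^ (2 * d)) (*-monoʳ-≤ (c ^ (k * e)) (^-monoˡ-≤ (d * k) u^e≤n)) ⟩
    n ^ (2 * d) * (c ^ (k * e) * n ^ (d * k))       ≡⟨ swap (n ^ (2 * d)) (c ^ (k * e)) (n ^ (d * k)) ⟩
    c ^ (k * e) * (n ^ (2 * d) * n ^ (d * k))       ≡⟨ cong (c ^ (k * e) *_) (trans (sym (^-distribˡ-+-* n (2 * d) (d * k)))
                                                                                (cong (n ^_) (exponents k))) ⟩
    c ^ (k * e) * n ^ E                             ≤⟨ *-monoʳ-≤ (c ^ (k * e)) (^-mono-≤-* E {n} {8} {L} n≤8L) ⟩
    c ^ (k * e) * (8 ^ E * L ^ E)                   ≡⟨ sym (*-assoc (c ^ (k * e)) (8 ^ E) (L ^ E)) ⟩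
    c ^ (k * e) * 8 ^ E * L ^ E                     ∎
    where
    u^dke≡ : (u ^ d) ^ (k * e) ≡ (u ^ e) ^ (d * k)
    u^dke≡ = trans (^-*-assoc u d (k * e)) (trans (cong (u ^_) (lemma k)) (sym (^-*-assoc u e (d * k))))
      where lemma : ∀ k → suc k * (k * (suc k + 1)) ≡ (suc k + 1) * (suc k * k)
            lemma = ℕ.solve-∀
    swap : ∀ a b c → a * (b * c) ≡ b * (a * c)
    swap = ℕ.solve-∀
    exponents : ∀ k → 2 * suc k + suc k * k ≡ suc k * (suc k + 1)
    exponents = ℕ.solve-∀

  medium-estimate : ∀ {n p w σ L Cₙ Cₚ} → n ≤ Cₙ * w ^ e → p ≤ Cₚ * (w * σ) ^ d → w ≤ 2 * (L * σ) →
                    n ^ (2 * d) * p ^ (k * e) ≤ (Cₙ ^ (2 * d) * Cₚ ^ (k * e) * 2 ^ E) * (L * (w * σ) ^ d) ^ E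
  medium-estimate {n} {p} {w} {σ} {L} {Cₙ} {Cₚ} n≤ p≤ w≤2Lσ = begin
    n ^ (2 * d) * p ^ (k * e)
      ≤⟨ *-mono-≤ (^-mono-≤-* (2 * d) {n} {Cₙ} {w ^ e} n≤) (^-mono-≤-* (k * e) {p} {Cₚ} {(w * σ) ^ d} p≤) ⟩
    (Cₙ ^ (2 * d) * (w ^ e) ^ (2 * d)) * (Cₚ ^ (k * e) * ((w * σ) ^ d) ^ (k * e))
      ≡⟨ cong₂ (λ a b → (Cₙ ^ (2 * d) * a) * (Cₚ ^ (k * e) * b)) w≡ wσ≡ ⟩
    (Cₙ ^ (2 * d) * (w ^ 2) ^ E) * (Cₚ ^ (k * e) * ((w * σ) ^ k) ^ E)
      ≡⟨ regroup (Cₙ ^ (2 * d)) ((w ^ 2) ^ E) (Cₚ ^ (k * e)) (((w * σ) ^ k) ^ E) ⟩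
    (Cₙ ^ (2 * d) * Cₚ ^ (k * e)) * ((w ^ 2) ^ E * ((w * σ) ^ k) ^ E)
      ≡⟨ cong ((Cₙ ^ (2 * d) * Cₚ ^ (k * e)) *_) (sym (^-distribʳ-* (w ^ 2) ((w * σ) ^ k) E)) ⟩
    (Cₙ ^ (2 * d) * Cₚ ^ (k * e)) * (w ^ 2 * (w * σ) ^ k) ^ E
      ≤⟨ *-monoʳ-≤ (Cₙ ^ (2 * d) * Cₚ ^ (k * e)) (^-mono-≤-* E {w ^ 2 * (w * σ) ^ k} {2} {L * (w * σ) ^ d} base≤) ⟩
    (Cₙ ^ (2 * d) * Cₚ ^ (k * e)) * (2 ^ E * (L * (w * σ) ^ d) ^ E)
      ≡⟨ sym (*-assoc (Cₙ ^ (2 * d) * Cₚ ^ (k * e)) (2 ^ E) ((L * (w * σ) ^ d) ^ E)) ⟩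
    (Cₙ ^ (2 * d) * Cₚ ^ (k * e) * 2 ^ E) * (L * (w * σ) ^ d) ^ E ∎
    where
    w≡ : (w ^ e) ^ (2 * d) ≡ (w ^ 2) ^ E
    w≡ = trans (^-*-assoc w e (2 * d)) (trans (cong (w ^_) (lemma k)) (sym (^-*-assoc w 2 E)))
      where lemma : ∀ k → (suc k + 1) * (2 * suc k) ≡ 2 * (suc k * (suc k + 1))
            lemma = ℕ.solve-∀
    wσ≡ : ((w * σ) ^ d) ^ (k * e) ≡ ((w * σ) ^ k) ^ E
    wσ≡ = trans (^-*-assoc (w * σ) d (k * e)) (trans (cong ((w * σ) ^_) (lemma k)) (sym (^-*-assoc (w * σ) k E)))
      where lemma : ∀ k → suc k * (k * (suc k + 1)) ≡ k * (suc k * (suc k + 1))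
            lemma = ℕ.solve-∀
    regroup : ∀ a b c f → a * b * (c * f) ≡ a * c * (b * f)
    regroup = ℕ.solve-∀
    base≤ : w ^ 2 * (w * σ) ^ k ≤ 2 * (L * (w * σ) ^ d)
    base≤ = begin
      w * (w * 1) * (w * σ) ^ k           ≤⟨ *-monoˡ-≤ ((w * σ) ^ k) (*-monoˡ-≤ (w * 1) w≤2Lσ) ⟩
      2 * (L * σ) * (w * 1) * (w * σ) ^ k ≡⟨ lemma L σ w ((w * σ) ^ k) ⟩
      2 * (L * ((w * σ) * (w * σ) ^ k))   ∎
      where lemma : ∀ L σ w x → 2 * (L * σ) * (w * 1) * x ≡ 2 * (L * ((w * σ) * x))
            lemma = ℕ.solve-∀

  dense-estimate-vertices : ∀ {n p v C M} → n ≤ C * v ^ E → p ≤ n * n → v ^ (2 * suc k₃) ≤ M →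
                            n ^ (2 * d) * p ^ (k * e) ≤ C ^ (2 * suc k₃) * M ^ E
  dense-estimate-vertices {n} {p} {v} {C} {M} n≤ p≤n² v≤M = begin
    n ^ (2 * d) * p ^ (k * e)         ≤⟨ *-monoʳ-≤ (n ^ (2 * d)) (^-monoˡ-≤ (k * e) p≤n²) ⟩
    n ^ (2 * d) * (n * n) ^ (k * e)   ≡⟨ cong (n ^ (2 * d) *_) (trans (^-distribʳ-* n n (k * e)) (sym (^-distribˡ-+-* n (k * e) (k * e)))) ⟩
    n ^ (2 * d) * n ^ (k * e + k * e) ≡⟨ trans (sym (^-distribˡ-+-* n (2 * d) (k * e + k * e))) (cong (n ^_) (exponents k)) ⟩
    n ^ F                             ≤⟨ ^-mono-≤-* F {n} {C} {v ^ E} n≤ ⟩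
    C ^ F * (v ^ E) ^ F               ≡⟨ cong (C ^ F *_) (^-^-comm v E F) ⟩
    C ^ F * (v ^ F) ^ E               ≤⟨ *-monoʳ-≤ (C ^ F) (^-monoˡ-≤ E v≤M) ⟩
    C ^ F * M ^ E                     ∎
    where
    F = 2 * suc k₃
    exponents : ∀ k → 2 * suc k + (k * (suc k + 1) + k * (suc k + 1)) ≡ 2 * suc (k * (k + 3))
    exponents = ℕ.solve-∀

  dense-estimate-pairs : ∀ {n p u Cₙ Cₚ M} → p ≤ Cₚ * M → n ≤ Cₙ * u ^ e → u ^ (2 * d) ≤ p →
                         n ^ (2 * d) * p ^ (k * e) ≤ (Cₙ ^ (2 * d) * Cₚ ^ E) * M ^ E
  dense-estimate-pairs {n} {p} {u} {Cₙ} {Cₚ} {M} p≤ n≤ u^2d≤p = begin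
    n ^ (2 * d) * p ^ (k * e)                      ≤⟨ *-monoˡ-≤ (p ^ (k * e)) (^-mono-≤-* (2 * d) {n} {Cₙ} {u ^ e} n≤) ⟩
    Cₙ ^ (2 * d) * (u ^ e) ^ (2 * d) * p ^ (k * e) ≡⟨ cong (λ z → Cₙ ^ (2 * d) * z * p ^ (k * e)) (^-^-comm u e (2 * d)) ⟩
    Cₙ ^ (2 * d) * (u ^ (2 * d)) ^ e * p ^ (k * e) ≤⟨ *-monoˡ-≤ (p ^ (k * e)) (*-monoʳ-≤ (Cₙ ^ (2 * d)) (^-monoˡ-≤ e u^2d≤p)) ⟩
    Cₙ ^ (2 * d) * p ^ e * p ^ (k * e)             ≡⟨ trans (*-assoc (Cₙ ^ (2 * d)) (p ^ e) (p ^ (k * e)))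
                                                          (cong (Cₙ ^ (2 * d) *_) (trans (sym (^-distribˡ-+-* p e (k * e)))
                                                                                         (cong (p ^_) (exponents k)))) ⟩
    Cₙ ^ (2 * d) * p ^ E                           ≤⟨ *-monoʳ-≤ (Cₙ ^ (2 * d)) (^-mono-≤-* E {p} {Cₚ} {M} p≤) ⟩
    Cₙ ^ (2 * d) * (Cₚ ^ E * M ^ E)                ≡⟨ sym (*-assoc (Cₙ ^ (2 * d)) (Cₚ ^ E) (M ^ E)) ⟩
    Cₙ ^ (2 * d) * Cₚ ^ E * M ^ E                  ∎
    where exponents : ∀ k → suc k + 1 + k * (suc k + 1) ≡ suc k * (suc k + 1)
          exponents = ℕ.solve-∀

module Regimes (j : ℕ) where
  open import Data.Nat
  open import Data.Nat.Properties
  open import Data.Nat.DivMod using (_/_; m/n*n≤m; m≥n⇒m/n>0)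
  import Data.Nat.Tactic.RingSolver as ℕ
  open import Data.Bool using (false)
  open import Data.List using ([]; length)
  open import Data.List.Relation.Unary.AllPairs using ([])
  open import Data.Product using (Σ; _×_; _,_; proj₁; proj₂)
  open import Relation.Nullary using (¬_; Dec; yes; no; contradiction; _×-dec_)
  open import Relation.Binary.PropositionalEquality
  open Arithmetic
  open LowerBound

  k : ℕ
  k = suc j

  open Estimates k

  Bound : ℕ → ℕ → ℕ → ℕ → Set
  Bound K n p s = n ^ (2 * d) * p ^ ((d ∸ 1) * (d + 1)) ≤ K * s ^ (d * (d + 1))

  Bound-mono : ∀ {K K′ n p s} → K ≤ K′ → Bound K n p s → Bound K′ n p s
  Bound-mono {s = s} K≤K′ bound = ≤-trans bound (*-monoˡ-≤ (s ^ E) K≤K′)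

  weaken : ∀ {K K′ n p} → K ≤ K′ → OracleLowerBound n p (Bound K n p) → OracleLowerBound n p (Bound K′ n p)
  weaken {K} {K′} {n} {p} K≤K′ = OracleLowerBound-mono {A = Bound K n p} (λ {s} → Bound-mono {K} {K′} {n} {p} {s} K≤K′)

  from-layout : ∀ K {m p} k′ L₀ σ a₀ b₀ → let open Layout k′ L₀ σ a₀ b₀ in
                vertexCount ≤ suc m → lineCount ≤ p → p ≤ suc m * suc m → Bound K (suc m) p queryCount →
                OracleLowerBound (suc m) p (Bound K (suc m) p)
  from-layout K {m} {p} k′ L₀ σ a₀ b₀ fits lines≤p p≤n² bound =
    OracleLowerBound-mono {A = queryCount ≤_} (λ queries≤s → ≤-trans bound (*-monoʳ-≤ K (^-monoˡ-≤ E queries≤s)))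
      (OnVertices.queries-lower-bound m fits p lines≤p p≤n²)
    where open Layout k′ L₀ σ a₀ b₀

  no-pairs : ∀ K m → OracleLowerBound (suc m) 0 (Bound K (suc m) 0)
  no-pairs K m = [] , [] , refl , λ enc _ _ → empty , subst (_≤ K * length (enc empty) ^ E) (sym (*-zeroʳ (suc m ^ (2 * d)))) z≤n
    where empty = λ _ _ → false

  layers-for : ∀ t → Σ ℕ λ L₀ → 2 * (2 + L₀) ≤ 4 + t × 4 + t ≤ 8 * (1 + L₀)
  layers-for zero          = 0 , ≤-refl , s≤s (s≤s (s≤s (s≤s z≤n)))
  layers-for (suc zero)    = 0 , s≤s (s≤s (s≤s (s≤s z≤n))) , s≤s (s≤s (s≤s (s≤s (s≤s z≤n))))
  layers-for (suc (suc t)) with layers-for t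
  ... | L₀ , lower , upper =
    suc L₀ , subst (_≤ 4 + suc (suc t)) (sym (lemma₂ L₀)) (+-monoʳ-≤ 2 lower) ,
             ≤-trans (+-monoʳ-≤ 2 upper)
                     (subst (2 + 8 * suc L₀ ≤_) (sym (lemma₈ L₀)) (+-monoˡ-≤ (8 * suc L₀) {2} {8} (s≤s (s≤s z≤n))))
    where
    lemma₂ : ∀ L → 2 * (2 + suc L) ≡ 2 + 2 * (2 + L)
    lemma₂ = ℕ.solve-∀
    lemma₈ : ∀ L → 8 * (1 + suc L) ≡ 8 + 8 * (1 + L)
    lemma₈ = ℕ.solve-∀

  K₁ : ℕ
  K₁ = (2 ^ k) ^ (k * e) * 8 ^ E

  -- Few pairs: a single line (σ = 0) through ~n/2 layers.
  sparse-regime : ∀ {m p u} → 4 ≤ suc m → 1 ≤ p → p ≤ suc m * suc m → p ≤ 2 ^ k * u ^ d → u ^ e ≤ suc m →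
                  OracleLowerBound (suc m) p (Bound K₁ (suc m) p)
  sparse-regime {m} {p} {u} 4≤n 1≤p p≤n² p≤ u^e≤n =
    from-layout K₁ k L₀ 0 0 0 fits lines≤p p≤n² (begin
      suc m ^ (2 * d) * p ^ (k * e) ≤⟨ sparse-estimate {u = u} {2 ^ k} {L} p≤ u^e≤n (subst (_≤ 8 * L) n≡ upper) ⟩
      K₁ * L ^ E                     ≡⟨ cong (λ z → K₁ * z ^ E) (sym queries≡L) ⟩
      K₁ * queryCount ^ E            ∎)
    where
    open ≤-Reasoning
    n≡ : 4 + (suc m ∸ 4) ≡ suc m
    n≡ = m+[n∸m]≡n 4≤n
    L₀ = proj₁ (layers-for (suc m ∸ 4))
    lower = proj₁ (proj₂ (layers-for (suc m ∸ 4)))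
    upper = proj₂ (proj₂ (layers-for (suc m ∸ 4)))
    open Layout k L₀ 0 0 0
    lines≡1 : lineCount ≡ 1
    lines≡1 = trans lineCount≡ (cong₂ (λ a b → 1 * (a * b)) (^-zeroˡ k) (^-zeroˡ k))
    queries≡L : queryCount ≡ L
    queries≡L = trans (cong (L *_) lines≡1) (*-identityʳ L)
    lines≤p : lineCount ≤ p
    lines≤p = subst (_≤ p) (sym lines≡1) 1≤p
    fits : vertexCount ≤ suc m
    fits = begin
      vertexCount                                              ≡⟨ vertexCount≡ ⟩
      2 * (suc L * (suc (L * (k * 0)) * suc (L * 0) ^ k))      ≡⟨ cong₂ (λ a b → 2 * (suc L * (suc a * suc b ^ k)))
                                                                        (trans (cong (L *_) (*-zeroʳ k)) (*-zeroʳ L)) (*-zeroʳ L) ⟩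
      2 * (suc L * (1 * 1 ^ k))                                ≡⟨ cong (λ z → 2 * (suc L * (1 * z))) (^-zeroˡ k) ⟩
      2 * (suc L * 1)                                          ≡⟨ cong (2 *_) (*-identityʳ (suc L)) ⟩
      2 * (2 + L₀)                                             ≤⟨ lower ⟩
      4 + (suc m ∸ 4)                                          ≡⟨ n≡ ⟩
      suc m                                                    ∎

  Cᵥ : ℕ
  Cᵥ = 4 * (suc k * 2 ^ k)

  1≤Cᵥ : 1 ≤ Cᵥ
  1≤Cᵥ = *-mono-≤ {1} {4} (s≤s z≤n) (*-mono-≤ {1} {suc k} (s≤s z≤n) (1≤^ k (s≤s z≤n)))

  K₂ : ℕ
  K₂ = (Cᵥ * 2 ^ e) ^ (2 * d) * (2 ^ k * 2 ^ d) ^ (k * e) * 2 ^ E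

  -- Lines with base coordinates < u, directions ≤ σ and about u/σ layers.
  module MediumLayout {u σ L₀ a₀ b₀ : ℕ} (a₀≡ : suc a₀ ≡ u) (b₀≡ : suc b₀ ≡ u * σ) where
    open Layout k L₀ σ a₀ b₀ public
    open ≤-Reasoning

    vertexCount≤ : L * σ ≤ u → vertexCount ≤ Cᵥ * u ^ e
    vertexCount≤ Lσ≤u = begin
      vertexCount
        ≡⟨ vertexCount≡ ⟩
      2 * (suc L * (suc (b₀ + L * (k * (σ * σ))) * suc (a₀ + L * σ) ^ k))
        ≡⟨ cong₂ (λ a b → 2 * (suc L * ((a + L * (k * (σ * σ))) * (b + L * σ) ^ k))) b₀≡ a₀≡ ⟩
      2 * (suc L * ((u * σ + L * (k * (σ * σ))) * (u + L * σ) ^ k))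
        ≤⟨ *-monoʳ-≤ 2 (*-mono-≤ (1+m≤2m {L} (s≤s z≤n)) (*-mono-≤ (+-monoʳ-≤ (u * σ) heights) (^-monoˡ-≤ k coordinates))) ⟩
      2 * (2 * L * ((u * σ + k * (σ * u)) * (2 * u) ^ k))
        ≡⟨ cong (λ z → 2 * (2 * L * ((u * σ + k * (σ * u)) * z))) (^-distribʳ-* 2 u k) ⟩
      2 * (2 * L * ((u * σ + k * (σ * u)) * (2 ^ k * u ^ k)))
        ≡⟨ lemma L σ u (u ^ k) (2 ^ k) k ⟩
      Cᵥ * (L * σ * (u * u ^ k))
        ≤⟨ *-monoʳ-≤ Cᵥ (*-monoˡ-≤ (u * u ^ k) Lσ≤u) ⟩
      Cᵥ * (u * (u * u ^ k))
        ≡⟨ cong (λ z → Cᵥ * u ^ z) (+-comm 1 d) ⟩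
      Cᵥ * u ^ e ∎
      where
      heights : L * (k * (σ * σ)) ≤ k * (σ * u)
      heights = subst (_≤ k * (σ * u)) (lemmaₕ L k σ) (*-monoʳ-≤ k (*-monoʳ-≤ σ Lσ≤u))
        where lemmaₕ : ∀ L k σ → k * (σ * (L * σ)) ≡ L * (k * (σ * σ))
              lemmaₕ = ℕ.solve-∀
      coordinates : u + L * σ ≤ 2 * u
      coordinates = subst (u + L * σ ≤_) (cong (u +_) (sym (+-identityʳ u))) (+-monoʳ-≤ u Lσ≤u)
      lemma : ∀ L σ u x c k → 2 * (2 * L * ((u * σ + k * (σ * u)) * (c * x))) ≡ 4 * (suc k * c) * (L * σ * (u * x))
      lemma = ℕ.solve-∀

    lineCount≡ᵤ : lineCount ≡ u * σ * (u ^ k * suc σ ^ k)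
    lineCount≡ᵤ = trans lineCount≡ (cong₂ (λ a b → a * (b ^ k * suc σ ^ k)) b₀≡ a₀≡)

    lineCount≤ : 1 ≤ σ → lineCount ≤ 2 ^ k * u ^ d * σ ^ d
    lineCount≤ 1≤σ = begin
      lineCount                         ≡⟨ lineCount≡ᵤ ⟩
      u * σ * (u ^ k * suc σ ^ k)       ≤⟨ *-monoʳ-≤ (u * σ) (*-monoʳ-≤ (u ^ k) (suc-^≤ k 1≤σ)) ⟩
      u * σ * (u ^ k * (2 ^ k * σ ^ k)) ≡⟨ lemma u σ (u ^ k) (σ ^ k) (2 ^ k) ⟩
      2 ^ k * u ^ d * σ ^ d             ∎
      where lemma : ∀ u σ x y c → u * σ * (x * (c * y)) ≡ c * (u * x) * (σ * y)
            lemma = ℕ.solve-∀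

    queryCount≥ : L * (u * σ) ^ d ≤ queryCount
    queryCount≥ = begin
      L * (u * σ) ^ d                     ≡⟨ cong (λ z → L * (u * σ * z)) (^-distribʳ-* u σ k) ⟩
      L * (u * σ * (u ^ k * σ ^ k))       ≤⟨ *-monoʳ-≤ L (*-monoʳ-≤ (u * σ) (*-monoʳ-≤ (u ^ k) (^-monoˡ-≤ k (n≤1+n σ)))) ⟩
      L * (u * σ * (u ^ k * suc σ ^ k))   ≡⟨ cong (L *_) (sym lineCount≡ᵤ) ⟩
      queryCount                          ∎

  medium-layout : ∀ {m p u σ L₀ a₀ b₀} → p ≤ suc m * suc m → 1 ≤ u →
                  suc m < Cᵥ * suc u ^ e → Cᵥ * u ^ e ≤ suc m →
                  1 ≤ σ → p < 2 ^ k * u ^ d * suc σ ^ d → 2 ^ k * u ^ d * σ ^ d ≤ p →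
                  suc L₀ * σ ≤ u → u ≤ 2 * (suc L₀ * σ) → suc a₀ ≡ u → suc b₀ ≡ u * σ →
                  OracleLowerBound (suc m) p (Bound K₂ (suc m) p)
  medium-layout {m} {p} {u} {σ} {L₀} {a₀} {b₀} p≤n² 1≤u n< u-fits 1≤σ p< σ-fits Lσ≤u u≤2Lσ a₀≡ b₀≡ =
    from-layout K₂ k L₀ σ a₀ b₀ (≤-trans (vertexCount≤ Lσ≤u) u-fits) (≤-trans (lineCount≤ 1≤σ) σ-fits) p≤n² (begin
      suc m ^ (2 * d) * p ^ (k * e)
        ≤⟨ medium-estimate {w = u} {σ} {L} {Cᵥ * 2 ^ e} {2 ^ k * 2 ^ d} (<c[1+u]ᵉ⇒≤c2ᵉuᵉ Cᵥ e 1≤u n<) p≤ u≤2Lσ ⟩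
      K₂ * (L * (u * σ) ^ d) ^ E
        ≤⟨ *-monoʳ-≤ K₂ (^-monoˡ-≤ E queryCount≥) ⟩
      K₂ * queryCount ^ E ∎)
    where
    open ≤-Reasoning
    open MediumLayout {u} {σ} {L₀} a₀≡ b₀≡
    p≤ : p ≤ (2 ^ k * 2 ^ d) * (u * σ) ^ d
    p≤ = ≤-trans (<⇒≤ p<) (begin
      2 ^ k * u ^ d * suc σ ^ d         ≤⟨ *-monoʳ-≤ (2 ^ k * u ^ d) (suc-^≤ d 1≤σ) ⟩
      2 ^ k * u ^ d * (2 ^ d * σ ^ d)   ≡⟨ lemma (2 ^ k) (u ^ d) (2 ^ d) (σ ^ d) ⟩
      (2 ^ k * 2 ^ d) * (u ^ d * σ ^ d) ≡⟨ cong ((2 ^ k * 2 ^ d) *_) (sym (^-distribʳ-* u σ d)) ⟩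
      (2 ^ k * 2 ^ d) * (u * σ) ^ d     ∎)
      where lemma : ∀ a b c f → a * b * (c * f) ≡ a * c * (b * f)
            lemma = ℕ.solve-∀

  medium-regime : ∀ {m p u} → p ≤ suc m * suc m → 1 ≤ u → suc m < Cᵥ * suc u ^ e → Cᵥ * u ^ e ≤ suc m →
                  2 ^ k * u ^ d ≤ p → p < 2 ^ k * u ^ (2 * d) → OracleLowerBound (suc m) p (Bound K₂ (suc m) p)
  medium-regime {m} {p} {u} p≤n² 1≤u n< fits-n p≥ p< =
    medium-layout {L₀ = pred L} {a₀ = pred u} {b₀ = pred (u * σ)} p≤n² 1≤u n< fits-n 1≤σ p<σ σ-fits
      (subst (λ z → z * σ ≤ u) (sym (suc-pred L)) (m/n*n≤m u σ))
      (subst (λ z → u ≤ 2 * (z * σ)) (sym (suc-pred L)) (m≤2*[m/n]*n u σ σ≤u))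
      (suc-pred u) (suc-pred (u * σ))
    where
    largest = largest-power-below (2 ^ k * u ^ d) d p (*-mono-≤ (1≤^ k (s≤s z≤n)) (1≤^ d 1≤u)) (s≤s z≤n) p≥
    σ = proj₁ largest
    1≤σ = proj₁ (proj₂ largest)
    σ-fits : 2 ^ k * u ^ d * σ ^ d ≤ p
    σ-fits = proj₁ (proj₂ (proj₂ largest))
    p<σ : p < 2 ^ k * u ^ d * suc σ ^ d
    p<σ = proj₂ (proj₂ (proj₂ largest))
    σ≤u : σ ≤ u
    σ≤u with σ ≤? u
    ... | yes σ≤u = σ≤u
    ... | no  σ≰u = contradiction (≤-trans (subst (_≤ 2 ^ k * u ^ d * σ ^ d) u^2d≡
                                              (*-monoʳ-≤ (2 ^ k * u ^ d) (^-monoˡ-≤ d (<⇒≤ (≰⇒> σ≰u))))) σ-fits) (<⇒≱ p<)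
      where u^2d≡ : 2 ^ k * u ^ d * u ^ d ≡ 2 ^ k * u ^ (2 * d)
            u^2d≡ = trans (*-assoc (2 ^ k) (u ^ d) (u ^ d))
                          (cong (2 ^ k *_) (sym (trans (cong (u ^_) (cong (d +_) (+-identityʳ d))) (^-distribˡ-+-* u d d))))
    instance
      _ = >-nonZero 1≤σ
    L = u / σ
    instance
      _ = >-nonZero 1≤u
      _ = >-nonZero (*-mono-≤ 1≤u 1≤σ)
      _ = >-nonZero (m≥n⇒m/n>0 {u} {σ} σ≤u)

  C₃ K₃ K₃′ : ℕ
  C₃  = 4 * (suc k₃ * 2 ^ k₃)
  K₃  = (C₃ * 2 ^ E) ^ (2 * suc k₃)
  K₃′ = (Cᵥ * 2 ^ e) ^ (2 * d) * (2 ^ k₃ * 2 ^ (2 * suc k₃)) ^ E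

  1≤C₃ : 1 ≤ C₃
  1≤C₃ = *-mono-≤ {1} {4} (s≤s z≤n) (*-mono-≤ {1} {suc k₃} (s≤s z≤n) (1≤^ k₃ (s≤s z≤n)))

  2+k₃≡E : 2 + k₃ ≡ E
  2+k₃≡E = lemma k
    where lemma : ∀ k → 2 + k * (k + 3) ≡ suc k * (suc k + 1)
          lemma = ℕ.solve-∀

  v²*[vᵏ*vᵏ]≡v^[2+2k] : ∀ v k → v * v * (v ^ k * v ^ k) ≡ v ^ (2 * suc k)
  v²*[vᵏ*vᵏ]≡v^[2+2k] v k = sym (trans (cong (v ^_) (cong (suc k +_) (+-identityʳ (suc k))))
                              (trans (^-distribˡ-+-* v (suc k) (suc k)) (lemma v (v ^ k))))
    where lemma : ∀ v x → v * x * (v * x) ≡ v * v * (x * x)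
          lemma = ℕ.solve-∀

  -- Many pairs: a single layer, with lines in dimension k₃ = E − 2 and all coordinates below v.
  module DenseLayout {v a₀ b₀ : ℕ} (a₀≡ : suc a₀ ≡ v) (b₀≡ : suc b₀ ≡ v * v) where
    open Layout k₃ 0 v a₀ b₀ public
    open ≤-Reasoning

    vertexCount≤ : vertexCount ≤ C₃ * v ^ E
    vertexCount≤ = begin
      vertexCount
        ≡⟨ vertexCount≡ ⟩
      2 * (2 * (suc (b₀ + 1 * (k₃ * (v * v))) * suc (a₀ + 1 * v) ^ k₃))
        ≡⟨ cong₂ (λ a b → 2 * (2 * ((a + 1 * (k₃ * (v * v))) * (b + 1 * v) ^ k₃))) b₀≡ a₀≡ ⟩
      2 * (2 * ((v * v + 1 * (k₃ * (v * v))) * (v + 1 * v) ^ k₃))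
        ≡⟨ cong (λ z → 2 * (2 * ((v * v + 1 * (k₃ * (v * v))) * z))) (^-distribʳ-* 2 v k₃) ⟩
      2 * (2 * ((v * v + 1 * (k₃ * (v * v))) * (2 ^ k₃ * v ^ k₃)))
        ≡⟨ lemma v (v ^ k₃) (2 ^ k₃) k₃ ⟩
      C₃ * v ^ (2 + k₃)
        ≡⟨ cong (λ z → C₃ * v ^ z) 2+k₃≡E ⟩
      C₃ * v ^ E ∎
      where lemma : ∀ v x c k → 2 * (2 * ((v * v + 1 * (k * (v * v))) * (c * x))) ≡ 4 * (suc k * c) * (v * (v * x))
            lemma = ℕ.solve-∀

    lineCount≡ᵥ : lineCount ≡ v * v * (v ^ k₃ * suc v ^ k₃)
    lineCount≡ᵥ = trans lineCount≡ (cong₂ (λ a b → a * (b ^ k₃ * suc v ^ k₃)) b₀≡ a₀≡)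

    lineCount≤ : 1 ≤ v → lineCount ≤ 2 ^ k₃ * v ^ (2 * suc k₃)
    lineCount≤ 1≤v = begin
      lineCount                               ≡⟨ lineCount≡ᵥ ⟩
      v * v * (v ^ k₃ * suc v ^ k₃)           ≤⟨ *-monoʳ-≤ (v * v) (*-monoʳ-≤ (v ^ k₃) (suc-^≤ k₃ 1≤v)) ⟩
      v * v * (v ^ k₃ * (2 ^ k₃ * v ^ k₃))    ≡⟨ lemma v (v ^ k₃) (2 ^ k₃) ⟩
      2 ^ k₃ * (v * v * (v ^ k₃ * v ^ k₃))    ≡⟨ cong (2 ^ k₃ *_) (v²*[vᵏ*vᵏ]≡v^[2+2k] v k₃) ⟩
      2 ^ k₃ * v ^ (2 * suc k₃)               ∎
      where lemma : ∀ v x c → v * v * (x * (c * x)) ≡ c * (v * v * (x * x))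
            lemma = ℕ.solve-∀

    queryCount≥ : v ^ (2 * suc k₃) ≤ queryCount
    queryCount≥ = begin
      v ^ (2 * suc k₃)                ≡⟨ sym (v²*[vᵏ*vᵏ]≡v^[2+2k] v k₃) ⟩
      v * v * (v ^ k₃ * v ^ k₃)       ≤⟨ *-monoʳ-≤ (v * v) (*-monoʳ-≤ (v ^ k₃) (^-monoˡ-≤ k₃ (n≤1+n v))) ⟩
      v * v * (v ^ k₃ * suc v ^ k₃)   ≡⟨ sym lineCount≡ᵥ ⟩
      lineCount                       ≡⟨ sym (+-identityʳ lineCount) ⟩
      queryCount                      ∎

  -- Whichever of the two constraints on v is tight at v + 1 bounds n or p in terms of the query count.
  dense-layout : ∀ {m p u v a₀ b₀} → p ≤ suc m * suc m → 1 ≤ u → suc m < Cᵥ * suc u ^ e → 2 ^ k * u ^ (2 * d) ≤ p →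
                 1 ≤ v → C₃ * v ^ E ≤ suc m → 2 ^ k₃ * v ^ (2 * suc k₃) ≤ p →
                 ¬ (C₃ * suc v ^ E ≤ suc m × 2 ^ k₃ * suc v ^ (2 * suc k₃) ≤ p) → suc a₀ ≡ v → suc b₀ ≡ v * v →
                 OracleLowerBound (suc m) p (Bound (K₃ + K₃′) (suc m) p)
  dense-layout {m} {p} {u} {v} {a₀} {b₀} p≤n² 1≤u n< u-fits 1≤v v-fits-n v-fits-p ¬fits a₀≡ b₀≡ =
    from-layout (K₃ + K₃′) k₃ 0 v a₀ b₀ (≤-trans vertexCount≤ v-fits-n) (≤-trans (lineCount≤ 1≤v) v-fits-p) p≤n² bound
    where
    open DenseLayout {v} a₀≡ b₀≡
    bound : Bound (K₃ + K₃′) (suc m) p queryCount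
    bound with C₃ * suc v ^ E ≤? suc m
    ... | no n<C₃[v+1]ᴱ = Bound-mono {n = suc m} {p} {queryCount} (m≤m+n K₃ K₃′)
      (dense-estimate-vertices {v = v} {C₃ * 2 ^ E} {queryCount}
        (<c[1+u]ᵉ⇒≤c2ᵉuᵉ C₃ E 1≤v (≰⇒> n<C₃[v+1]ᴱ)) p≤n² queryCount≥)
    ... | yes n≥C₃[v+1]ᴱ = Bound-mono {n = suc m} {p} {queryCount} (m≤n+m K₃′ K₃)
      (dense-estimate-pairs {u = u} {Cᵥ * 2 ^ e} {2 ^ k₃ * 2 ^ (2 * suc k₃)} {queryCount}
        p≤ (<c[1+u]ᵉ⇒≤c2ᵉuᵉ Cᵥ e 1≤u n<) u^2d≤p)
      where
      open ≤-Reasoning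
      p≤ : p ≤ 2 ^ k₃ * 2 ^ (2 * suc k₃) * queryCount
      p≤ = ≤-trans (<⇒≤ (≰⇒> (λ p≥ → ¬fits (n≥C₃[v+1]ᴱ , p≥)))) (begin
        2 ^ k₃ * suc v ^ (2 * suc k₃)                 ≤⟨ *-monoʳ-≤ (2 ^ k₃) (suc-^≤ (2 * suc k₃) 1≤v) ⟩
        2 ^ k₃ * (2 ^ (2 * suc k₃) * v ^ (2 * suc k₃)) ≡⟨ sym (*-assoc (2 ^ k₃) _ _) ⟩
        2 ^ k₃ * 2 ^ (2 * suc k₃) * v ^ (2 * suc k₃)   ≤⟨ *-monoʳ-≤ (2 ^ k₃ * 2 ^ (2 * suc k₃)) queryCount≥ ⟩
        2 ^ k₃ * 2 ^ (2 * suc k₃) * queryCount         ∎)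
      u^2d≤p : u ^ (2 * d) ≤ p
      u^2d≤p = ≤-trans (m≤c*m (u ^ (2 * d)) (1≤^ k (s≤s z≤n))) u-fits

  dense-regime : ∀ {m p u} → p ≤ suc m * suc m → 1 ≤ u → suc m < Cᵥ * suc u ^ e →
                 2 ^ k₃ ≤ u → C₃ ≤ suc m → 2 ^ k * u ^ (2 * d) ≤ p →
                 OracleLowerBound (suc m) p (Bound (K₃ + K₃′) (suc m) p)
  dense-regime {m} {p} {u} p≤n² 1≤u n< 2^k₃≤u C₃≤n u-fits =
    dense-layout {a₀ = pred v} {b₀ = pred (v * v)} p≤n² 1≤u n< u-fits 1≤v
      (proj₁ v-fits) (proj₂ v-fits) ¬v+1-fits (suc-pred v) (suc-pred (v * v))
    where
    Fits : ℕ → Set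
    Fits v = C₃ * v ^ E ≤ suc m × 2 ^ k₃ * v ^ (2 * suc k₃) ≤ p
    fits? : ∀ v → Dec (Fits v)
    fits? v = C₃ * v ^ E ≤? suc m ×-dec 2 ^ k₃ * v ^ (2 * suc k₃) ≤? p
    1-fits : Fits 1
    1-fits = subst (_≤ suc m) (sym (trans (cong (C₃ *_) (^-zeroˡ E)) (*-identityʳ C₃))) C₃≤n ,
             subst (_≤ p) (sym (trans (cong (2 ^ k₃ *_) (^-zeroˡ (2 * suc k₃))) (*-identityʳ (2 ^ k₃))))
               (≤-trans 2^k₃≤u (≤-trans (m≤m^n u (2 * d) (s≤s z≤n)) (≤-trans (m≤c*m (u ^ (2 * d)) (1≤^ k (s≤s z≤n))) u-fits)))
    ¬n+1-fits : ¬ Fits (1 + suc m)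
    ¬n+1-fits (n+1-fits , _) =
      <⇒≱ (≤-trans (m≤m^n (2 + m) E (s≤s z≤n)) (m≤c*m (suc (suc m) ^ E) 1≤C₃)) n+1-fits
    last = last-before-failure Fits fits? (suc m) 1 1-fits ¬n+1-fits
    v = proj₁ last
    1≤v = proj₁ (proj₂ last)
    v-fits = proj₁ (proj₂ (proj₂ last))
    ¬v+1-fits = proj₂ (proj₂ (proj₂ last))
    instance
      _ = >-nonZero 1≤v
      _ = >-nonZero (*-mono-≤ 1≤v 1≤v)

  K N : ℕ
  K = K₁ + (K₂ + (K₃ + K₃′))
  N = Cᵥ * (2 ^ k₃) ^ e + C₃ + 8

  -- u is the side length that fills the vertex budget, n ≈ Cᵥ · u^(d+1); p is compared with u^d and u^(2d).
  lower-bound : ∀ n → 1 ≤ n → N ≤ n → ∀ p → p ≤ n * n → OracleLowerBound n p (Bound K n p)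
  lower-bound (suc m) _ N≤n = by-size
    where
    Cᵥ*2^k₃ᵉ≤n : Cᵥ * (2 ^ k₃) ^ e ≤ suc m
    Cᵥ*2^k₃ᵉ≤n = ≤-trans (≤-trans (m≤m+n (Cᵥ * (2 ^ k₃) ^ e) C₃) (m≤m+n _ 8)) N≤n
    C₃≤n : C₃ ≤ suc m
    C₃≤n = ≤-trans (≤-trans (m≤n+m C₃ (Cᵥ * (2 ^ k₃) ^ e)) (m≤m+n _ 8)) N≤n
    4≤n : 4 ≤ suc m
    4≤n = ≤-trans (m≤m+n 4 4) (≤-trans (m≤n+m 8 _) N≤n)
    largest = largest-power-below Cᵥ e (suc m) 1≤Cᵥ (s≤s z≤n)
                (≤-trans (m≤m*c Cᵥ (1≤^ e (1≤^ k₃ (s≤s z≤n)))) Cᵥ*2^k₃ᵉ≤n)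
    u = proj₁ largest
    1≤u = proj₁ (proj₂ largest)
    u-fits : Cᵥ * u ^ e ≤ suc m
    u-fits = proj₁ (proj₂ (proj₂ largest))
    n< : suc m < Cᵥ * suc u ^ e
    n< = proj₂ (proj₂ (proj₂ largest))
    u^e≤n : u ^ e ≤ suc m
    u^e≤n = ≤-trans (m≤c*m (u ^ e) 1≤Cᵥ) u-fits
    2^k₃≤u : 2 ^ k₃ ≤ u
    2^k₃≤u with 2 ^ k₃ ≤? u
    ... | yes ≤u = ≤u
    ... | no  ≰u = contradiction (≤-trans (*-monoʳ-≤ Cᵥ (^-monoˡ-≤ e (≰⇒> ≰u))) Cᵥ*2^k₃ᵉ≤n) (<⇒≱ n<)

    by-size : ∀ p → p ≤ suc m * suc m → OracleLowerBound (suc m) p (Bound K (suc m) p)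
    by-size zero    _    = no-pairs K m
    by-size (suc q) p≤n² with suc q <? 2 ^ k * u ^ d | suc q <? 2 ^ k * u ^ (2 * d)
    ... | yes sparse | _          = weaken (m≤m+n K₁ _)
                                      (sparse-regime {u = u} 4≤n (s≤s z≤n) p≤n² (<⇒≤ sparse) u^e≤n)
    ... | no ¬sparse | yes medium = weaken (≤-trans (m≤m+n K₂ _) (m≤n+m _ K₁))
                                      (medium-regime p≤n² 1≤u n< u-fits (≮⇒≥ ¬sparse) medium)
    ... | no _       | no ¬medium = weaken (≤-trans (m≤n+m (K₃ + K₃′) K₂) (m≤n+m _ K₁))
                                      (dense-regime p≤n² 1≤u n< 2^k₃≤u C₃≤n (≮⇒≥ ¬medium))

open import Data.Nat using (suc; _≤_; _*_; _+_; _∸_; _^_; s≤s; z≤n)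
open import Data.Bool using (Bool)
open import Data.Fin using (Fin)
open import Data.Product using (Σ; _×_; _,_)
open import Data.List using (List; length)
open import Data.List.Relation.Unary.Unique.Propositional using (Unique)
open import Relation.Binary.PropositionalEquality using (_≡_)

theorem1p4 : (d : ℕ) → 2 ≤ d → (p : ℕ → ℕ) → (∀ n → p n ≤ n * n) →
    Σ ℕ λ K → Σ ℕ λ N → (n : ℕ) → 1 ≤ n → N ≤ n →
    Σ (List (Fin n × Fin n)) λ P → Unique P × length P ≡ p n ×
      ((enc : Graph n → List Bool) (query : List Bool → Fin n → Fin n → Fault n → Bool) →
        IsFTOracle P enc query →
        Σ (Graph n) λ G →
          n ^ (2 * d) * p n ^ ((d ∸ 1) * (d + 1)) ≤ K * length (enc G) ^ (d * (d + 1)))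
theorem1p4 (suc (suc j)) (s≤s (s≤s z≤n)) p p≤n² = K , N , λ n 1≤n N≤n → lower-bound n 1≤n N≤n (p n) (p≤n² n)
  where open Regimes j
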